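{- For all $x,y\in(0,1]$, $\phi(x,y)=\phi(y,x)$.
   Context: All graphs are finite, with no loops or multiple edges. $(0,1]$ is the set of reals $t$ with $0<t\le 1$. A tripartition of a graph $G$ is a partition $(A,B,C)$ of $V(G)$ into three nonempty stable (independent) sets. For $x,y\in(0,1]$, $G$ is $(x,y)$-constrained via a tripartition $(A,B,C)$ if every vertex in $A$ has at least $x|B|$ neighbours in $B$, every vertex in $B$ has at least $y|C|$ neighbours in $C$, and there are no edges between $A$ and $C$. $N^2(v)$ is the set of vertices at distance exactly two from $v$, and $N^2_A(v)=N^2(v)\cap A$. $\phi(x,y)$ is the maximum $z\in(0,1]$ (it exists) such that for every graph $G$ that is $(x,y)$-constrained via some $(A,B,C)$, there is a vertex $v\in C$ with $|N^2_A(v)|\ge z|A|$. -}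

module Defs where

import Algebra.Properties.CommutativeMonoid.Sum
open import Data.Bool.Base using (Bool; true; false; T; _∧_; if_then_else_)
open import Data.Bool.Properties using (T?; T-≡; T-∧)
open import Data.Fin.Base using (Fin; zero; suc)
import Data.Fin.Properties as Fin
open import Data.Fin.Subset using (Subset; _∈_; _∉_; _∩_; _∪_; ⊤; ∣_∣; Nonempty; Empty)
open import Data.Fin.Subset.Properties
  using (_∈?_; drop-there; x∈p∩q⁺; x∈p∩q⁻; p⊆q⇒∣p∣≤∣q∣)
open import Data.Integer.Base using (+_; -[1+_]; +≤+; +<+)
import Data.Integer.Base as ℤ
import Data.Integer.Properties as ℤ
import Data.List.Base as List
open import Data.List.Extrema using (argmax; argmax-all; f[xs]≤f[argmax])
open import Data.List.Membership.Propositional.Properties using (∈-allFin; ∈-filter⁺)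
import Data.List.Relation.Unary.All as All
open import Data.List.Relation.Unary.All.Properties using (all-filter)
open import Data.Nat.Base using (ℕ; zero; suc)
import Data.Nat.Base as ℕ
import Data.Nat.Properties as ℕ
open import Data.Product.Base using (∃; ∃-syntax; _×_; _,_; proj₁; proj₂)
open import Data.Rational.Base using (ℚ; mkℚ; 0ℚ; 1ℚ; _/_; toℚᵘ)
import Data.Rational.Base as ℚ
import Data.Rational.Properties as ℚ
open import Data.Rational.Unnormalised.Base using (mkℚᵘ; *≤*)
import Data.Rational.Unnormalised.Base as ℚᵘ
import Data.Rational.Unnormalised.Properties as ℚᵘ
open import Data.Vec.Base using (_∷_; []; tabulate; here; there)
open import Data.Vec.Properties using (lookup∘tabulate; []=⇒lookup; lookup⇒[]=)
open import Function.Base using (_∘_; id)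
open import Function.Bundles using (Equivalence)
open import Relation.Binary.PropositionalEquality
  using (_≡_; refl; sym; trans; cong; subst)
open import Relation.Nullary using (¬_; Dec; yes; no; does; contradiction)
open import Relation.Nullary.Decidable using (decidable-stable; _×-dec_; ¬?; toWitness; dec-true)

------------------------------------------------------------------------
-- Real numbers

-- A real number is given by the rationals strictly below it.  Classically
-- `stable` and the ¬ ¬ in `rounded` say nothing, and these are exactly the lower
-- Dedekind cuts; constructively they are what makes bounded suprema exist.
record ℝ : Set₁ where
  field
    Below     : ℚ → Set
    stable    : ∀ {q} → ¬ ¬ Below q → Below q
    down      : ∀ {p q} → p ℚ.≤ q → Below q → Below p
    rounded   : ∀ {p} → Below p → ¬ ¬ (∃[ q ] p ℚ.< q × Below q)
    inhabited : ∃[ q ] Below q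
    bounded   : ∃[ q ] ¬ Below q

open ℝ using (Below)

infix 4 _≤_ _≥_ _<_ _≃_

_≤_ _≥_ _<_ _≃_ : ℝ → ℝ → Set
x ≤ y = ∀ {q} → Below x q → Below y q
x ≥ y = y ≤ x
x < y = ¬ (y ≤ x)
x ≃ y = x ≤ y × y ≤ x

fromℚ : ℚ → ℝ
fromℚ r = record
  { Below     = ℚ._< r
  ; stable    = decidable-stable (_ ℚ.<? r)
  ; down      = ℚ.≤-<-trans
  ; rounded   = λ p<r k → k (let q , p<q , q<r = ℚ.<-dense p<r in q , p<q , q<r)
  ; inhabited = r ℚ.- 1ℚ , r-1<r
  ; bounded   = r , ℚ.<-irrefl refl
  }
  where
  r-1<r : r ℚ.- 1ℚ ℚ.< r
  r-1<r = subst (r ℚ.- 1ℚ ℚ.<_) (ℚ.+-identityʳ r)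
    (ℚ.+-monoʳ-< r {ℚ.- 1ℚ} {0ℚ} (toWitness {a? = ℚ.- 1ℚ ℚ.<? 0ℚ} _))

ι : ℕ → ℚ
ι m = + m / 1

fromℕ : ℕ → ℝ
fromℕ = fromℚ ∘ ι

0ℝ 1ℝ : ℝ
0ℝ = fromℕ 0
1ℝ = fromℕ 1

infixl 7 _·_

-- x · m is the product of x and m: the supremum of the p * m with p < x.
_·_ : ℝ → ℕ → ℝ
x · m = record
  { Below     = λ q → ¬ ¬ (∃[ p ] Below x p × q ℚ.< p ℚ.* ι m)
  ; stable    = λ h k → h (λ h′ → h′ k)
  ; down      = λ q≤r h k → h λ (p , p<x , r<pm) → k (p , p<x , ℚ.≤-<-trans q≤r r<pm)
  ; rounded   = λ h k → h λ (p , p<x , q<pm) →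
      let r , q<r , r<pm = ℚ.<-dense q<pm
      in k (r , q<r , λ k′ → k′ (p , p<x , r<pm))
  ; inhabited =
      let p , p<x  = ℝ.inhabited x
          q , q<pm = ℝ.inhabited (fromℚ (p ℚ.* ι m))
      in q , λ k → k (p , p<x , q<pm)
  ; bounded   =
      let b , b≮x = ℝ.bounded x
      in b ℚ.* ι m , λ h → h λ (p , p<x , bm<pm) →
        b≮x (ℝ.down x (ℚ.<⇒≤ (ℚ.*-cancelʳ-<-nonNeg (ι m) {{ℚ.normalize-nonNeg m 1}} bm<pm)) p<x)
  }

record ⟨0,1] : Set₁ where
  constructor mk
  field
    value   : ℝ
    0<value : 0ℝ < value
    value≤1 : value ≤ 1ℝ

open ⟨0,1] public using (value)

------------------------------------------------------------------------
-- Graphs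

record Graph : Set where
  field
    order       : ℕ
    adjacent    : Fin order → Fin order → Bool
    symmetric   : ∀ u v → adjacent u v ≡ adjacent v u
    irreflexive : ∀ v → adjacent v v ≡ false

module _ (G : Graph) where
  open Graph G

  Vertex : Set
  Vertex = Fin order

  Adj : Vertex → Vertex → Set
  Adj u v = T (adjacent u v)

  N : Vertex → Subset order
  N v = tabulate (adjacent v)

  Walk : ℕ → Vertex → Vertex → Set
  Walk zero    u v = u ≡ v
  Walk (suc k) u v = ∃[ w ] Adj u w × Walk k w v

  Distance : ℕ → Vertex → Vertex → Set
  Distance k u v = Walk k u v × (∀ {j} → j ℕ.< k → ¬ Walk j u v)

  walk? : ∀ k u v → Dec (Walk k u v)
  walk? zero    u v = u Fin.≟ v
  walk? (suc k) u v = Fin.any? λ w → T? (adjacent u w) ×-dec walk? k w v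

  distance? : ∀ k u v → Dec (Distance k u v)
  distance? k u v = walk? k u v ×-dec ℕ.allUpTo? (λ j → ¬? (walk? j u v)) k

  N² : Vertex → Subset order
  N² v = tabulate λ u → does (distance? 2 v u)

  Stable : Subset order → Set
  Stable S = ∀ {u v} → u ∈ S → v ∈ S → ¬ Adj u v

  record Tripartition (A B C : Subset order) : Set where
    field
      A≢∅    : Nonempty A
      B≢∅    : Nonempty B
      C≢∅    : Nonempty C
      A∩B≡∅  : Empty (A ∩ B)
      B∩C≡∅  : Empty (B ∩ C)
      A∩C≡∅  : Empty (A ∩ C)
      cover  : A ∪ B ∪ C ≡ ⊤
      stable-A : Stable A
      stable-B : Stable B
      stable-C : Stable C

  record Constrained (x y : ⟨0,1]) (A B C : Subset order) : Set where
    field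
      tripartition : Tripartition A B C
      A→B   : ∀ {a} → a ∈ A → fromℕ ∣ N a ∩ B ∣ ≥ value x · ∣ B ∣
      B→C   : ∀ {b} → b ∈ B → fromℕ ∣ N b ∩ C ∣ ≥ value y · ∣ C ∣
      no-AC : ∀ {a c} → a ∈ A → c ∈ C → ¬ Adj a c

------------------------------------------------------------------------
-- The function φ

Reaches : (x y : ⟨0,1]) → ℝ → Set
Reaches x y z =
  ∀ G A B C → Constrained G x y A B C →
  ∃[ v ] v ∈ C × fromℕ ∣ N² G v ∩ A ∣ ≥ z · ∣ A ∣

IsMaximum : (⟨0,1] → Set) → ⟨0,1] → Set₁
IsMaximum P z = P z × (∀ w → P w → value w ≤ value z)

-- φ x y is defined at the end of the file, as the maximum z in (0,1] with
-- Reaches x y z.  What precedes it shows that this maximum exists: it is at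
-- least y, by averaging |N²(c) ∩ A| over c in C, and it is attained because
-- each graph offers only finitely many v.

private
  open module ℕ∑ = Algebra.Properties.CommutativeMonoid.Sum ℕ.+-0-commutativeMonoid
    using (sum; ∑-comm)

  ι≤⇒ : ∀ p {n} → ℚ.↥ p ≡ + n → ∀ m k → p ℚ.* ι m ℚ.≤ ι k → n ℕ.* m ℕ.≤ k ℕ.* ℚ.↧ₙ p
  ι≤⇒ p@(mkℚ (+ n) d _) refl m k h = ℤ.drop‿+≤+ (cast (ℚᵘ.drop-*≤* (begin
    mkℚᵘ (+ n) d ℚᵘ.* mkℚᵘ (+ m) 0    ≃⟨ ℚᵘ.*-congˡ {mkℚᵘ (+ n) d} (ℚ.toℚᵘ-fromℚᵘ (mkℚᵘ (+ m) 0)) ⟨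
    toℚᵘ p ℚᵘ.* toℚᵘ (ι m) ≃⟨ ℚ.toℚᵘ-homo-* p (ι m) ⟨
    toℚᵘ (p ℚ.* ι m)      ≤⟨ ℚ.toℚᵘ-mono-≤ h ⟩
    toℚᵘ (ι k)                        ≃⟨ ℚ.toℚᵘ-fromℚᵘ (mkℚᵘ (+ k) 0) ⟩
    mkℚᵘ (+ k) 0                      ∎)))
    where
    open ℚᵘ.≤-Reasoning
    cast : (+ n ℤ.* + m) ℤ.* + 1 ℤ.≤ + k ℤ.* + suc (d ℕ.* 1) → + (n ℕ.* m) ℤ.≤ + (k ℕ.* suc d)
    cast rewrite ℤ.*-identityʳ (+ n ℤ.* + m) | ℕ.*-identityʳ d
               | ℤ.pos-* n m | ℤ.pos-* k (suc d) = id

  ι≤⇐ : ∀ p {n} → ℚ.↥ p ≡ + n → ∀ m k → n ℕ.* m ℕ.≤ k ℕ.* ℚ.↧ₙ p → p ℚ.* ι m ℚ.≤ ι k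
  ι≤⇐ p@(mkℚ (+ n) d _) refl m k h = ℚ.toℚᵘ-cancel-≤ (begin
    toℚᵘ (p ℚ.* ι m)      ≃⟨ ℚ.toℚᵘ-homo-* p (ι m) ⟩
    toℚᵘ p ℚᵘ.* toℚᵘ (ι m) ≃⟨ ℚᵘ.*-congˡ {mkℚᵘ (+ n) d} (ℚ.toℚᵘ-fromℚᵘ (mkℚᵘ (+ m) 0)) ⟩
    mkℚᵘ (+ n) d ℚᵘ.* mkℚᵘ (+ m) 0    ≤⟨ *≤* (cast (+≤+ h)) ⟩
    mkℚᵘ (+ k) 0                      ≃⟨ ℚ.toℚᵘ-fromℚᵘ (mkℚᵘ (+ k) 0) ⟨
    toℚᵘ (ι k)                        ∎)
    where
    open ℚᵘ.≤-Reasoning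
    cast : + (n ℕ.* m) ℤ.≤ + (k ℕ.* suc d) → (+ n ℤ.* + m) ℤ.* + 1 ℤ.≤ + k ℤ.* + suc (d ℕ.* 1)
    cast rewrite ℤ.*-identityʳ (+ n ℤ.* + m) | ℕ.*-identityʳ d
               | ℤ.pos-* n m | ℤ.pos-* k (suc d) = id

  ↥-suc : ∀ {p} → 0ℚ ℚ.< p → ∃[ n ] ℚ.↥ p ≡ + suc n
  ↥-suc {mkℚ (+ zero)  _ _} (ℚ.*<* (+<+ ()))
  ↥-suc {mkℚ (+ suc n) _ _} _ = n , refl
  ↥-suc {mkℚ -[1+ _ ]  _ _} (ℚ.*<* ())

  ι-mono : ∀ m n → m ℕ.≤ n → ι m ℚ.≤ ι n
  ι-mono m n m≤n = ℚ.toℚᵘ-cancel-≤ (begin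
    toℚᵘ (ι m)   ≃⟨ ℚ.toℚᵘ-fromℚᵘ (mkℚᵘ (+ m) 0) ⟩
    mkℚᵘ (+ m) 0 ≤⟨ *≤* (ℤ.*-monoʳ-≤-nonNeg (+ 1) (+≤+ m≤n)) ⟩
    mkℚᵘ (+ n) 0 ≃⟨ ℚ.toℚᵘ-fromℚᵘ (mkℚᵘ (+ n) 0) ⟨
    toℚᵘ (ι n)   ∎)
    where open ℚᵘ.≤-Reasoning

·≤⇒ : ∀ x m n {p} → x · m ≤ fromℕ n → Below x p → p ℚ.* ι m ℚ.≤ ι n
·≤⇒ x m n h p<x = ℚ.≮⇒≥ λ n<pm → ℚ.<-irrefl refl (h λ k → k (_ , p<x , n<pm))

·≤⇐ : ∀ x m n → (∀ {p} → Below x p → p ℚ.* ι m ℚ.≤ ι n) → x · m ≤ fromℕ n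
·≤⇐ x m n h {q} q<xm = decidable-stable (q ℚ.<? _) λ q≮n →
  q<xm λ (p , p<x , q<pm) → q≮n (ℚ.<-≤-trans q<pm (h p<x))

0<⇒ : ∀ {x} → 0ℝ < x → Below x 0ℚ
0<⇒ {x} 0<x = ℝ.stable x λ 0≮x → 0<x λ {q} q<x →
  decidable-stable (q ℚ.<? 0ℚ) λ q≮0 → 0≮x (ℝ.down x (ℚ.≮⇒≥ q≮0) q<x)

·-mono : ∀ {x y} m → x ≤ y → x · m ≤ y · m
·-mono m x≤y h k = h λ (p , p<x , q<pm) → k (p , x≤y p<x , q<pm)

private
  does⁺ : ∀ {P : Set} (P? : Dec P) → P → T (does P?)
  does⁺ P? p = Equivalence.from T-≡ (dec-true P? p)

  does⁻ : ∀ {P : Set} (P? : Dec P) → T (does P?) → P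
  does⁻ (yes p) _ = p

  ∈-tabulate⁺ : ∀ {n} {f : Fin n → Bool} {i} → T (f i) → i ∈ tabulate f
  ∈-tabulate⁺ {f = f} {i} t =
    lookup⇒[]= i _ (trans (lookup∘tabulate f i) (Equivalence.to T-≡ t))

  ∈-tabulate⁻ : ∀ {n} {f : Fin n → Bool} {i} → i ∈ tabulate f → T (f i)
  ∈-tabulate⁻ {f = f} {i} i∈ =
    Equivalence.from T-≡ (trans (sym (lookup∘tabulate f i)) ([]=⇒lookup i∈))

  ind : Bool → ℕ
  ind b = if b then 1 else 0

  ∣tabulate∣ : ∀ {n} (f : Fin n → Bool) → ∣ tabulate f ∣ ≡ sum (ind ∘ f)
  ∣tabulate∣ {zero}  f = refl
  ∣tabulate∣ {suc n} f with f zero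
  ... | true  = cong suc (∣tabulate∣ (f ∘ suc))
  ... | false = ∣tabulate∣ (f ∘ suc)

  sum-lower : ∀ {n} (A : Subset n) (f : Fin n → ℕ) r →
              (∀ {i} → i ∈ A → r ℕ.≤ f i) → ∣ A ∣ ℕ.* r ℕ.≤ sum f
  sum-lower []          f r h = ℕ.z≤n
  sum-lower (true  ∷ A) f r h = ℕ.+-mono-≤ (h here) (sum-lower A (f ∘ suc) r (h ∘ there))
  sum-lower (false ∷ A) f r h =
    ℕ.m≤n⇒m≤o+n (f zero) (sum-lower A (f ∘ suc) r (h ∘ there))

  sum-upper : ∀ {n} (C : Subset n) (f : Fin n → ℕ) k →
              (∀ {i} → i ∈ C → f i ℕ.≤ k) → (∀ {i} → i ∉ C → f i ≡ 0) →
              sum f ℕ.≤ ∣ C ∣ ℕ.* k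
  sum-upper []          f k h h′ = ℕ.z≤n
  sum-upper (true  ∷ C) f k h h′ =
    ℕ.+-mono-≤ (h here) (sum-upper C (f ∘ suc) k (h ∘ there) λ i∉C → h′ (i∉C ∘ drop-there))
  sum-upper (false ∷ C) f k h h′ rewrite h′ {zero} (λ ()) =
    sum-upper C (f ∘ suc) k (h ∘ there) λ i∉C → h′ (i∉C ∘ drop-there)

  sum-scale : ∀ {n} (f : Fin n → ℕ) d → sum (λ i → f i ℕ.* d) ≡ sum f ℕ.* d
  sum-scale {zero}  f d = refl
  sum-scale {suc n} f d = trans (cong (f zero ℕ.* d ℕ.+_) (sum-scale (f ∘ suc) d))
    (sym (ℕ.*-distribʳ-+ d (f zero) (sum (f ∘ suc))))

  ∣∣>0 : ∀ {n} {S : Subset n} → Nonempty S → 0 ℕ.< ∣ S ∣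
  ∣∣>0 {S = true  ∷ S} _                 = ℕ.s≤s ℕ.z≤n
  ∣∣>0 {S = false ∷ S} (suc i , there m) = ∣∣>0 (i , m)

  ∣∣>0⁻ : ∀ {n} {S : Subset n} → 0 ℕ.< ∣ S ∣ → Nonempty S
  ∣∣>0⁻ {S = true  ∷ S} _ = zero , here
  ∣∣>0⁻ {S = false ∷ S} h = let i , m = ∣∣>0⁻ h in suc i , there m

  best : ∀ {n} (C : Subset n) (k : Fin n → ℕ) → Nonempty C →
         ∃[ v ] v ∈ C × (∀ {u} → u ∈ C → k u ℕ.≤ k v)
  best {n} C k (c , c∈C) =
    argmax ℕ.≤-totalOrder k c xs ,
    argmax-all ℕ.≤-totalOrder k c∈C (all-filter (_∈? C) (List.allFin n)) ,
    λ u∈C → All.lookup (f[xs]≤f[argmax] ℕ.≤-totalOrder {f = k} c xs)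
      (∈-filter⁺ (_∈? C) (∈-allFin _) u∈C)
    where xs = List.filter (_∈? C) (List.allFin n)

  module Averaging (x y : ⟨0,1]) {p : ℚ} (0<p : 0ℚ ℚ.< p) (p<y : Below (value y) p)
                   (G : Graph) (A B C : Subset (Graph.order G))
                   (con : Constrained G x y A B C) where
    open Graph G
    open Constrained con
    open Tripartition tripartition

    Adj-sym : ∀ {u v} → Adj G u v → Adj G v u
    Adj-sym {u} {v} = subst T (symmetric u v)

    a∈N²c : ∀ {a b c} → a ∈ A → c ∈ C → Adj G a b → Adj G b c → a ∈ N² G c
    a∈N²c {a} {b} {c} a∈A c∈C ab bc =
      ∈-tabulate⁺ (does⁺ (distance? G 2 c a) ((b , Adj-sym bc , a , Adj-sym ab , refl) , shorter))
      where
      shorter : ∀ {j} → j ℕ.< 2 → ¬ Walk G j c a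
      shorter {zero}        _ refl            = A∩C≡∅ (a , x∈p∩q⁺ (a∈A , c∈C))
      shorter {suc zero}    _ (_ , ca , refl) = no-AC a∈A c∈C (Adj-sym ca)
      shorter {suc (suc _)} (ℕ.s≤s (ℕ.s≤s ()))

    e : Vertex G → Vertex G → Bool
    e a c = does (c ∈? C) ∧ does (a ∈? N² G c ∩ A)

    neighbour : ∀ {a} → a ∈ A → ¬ ¬ (∃[ b ] b ∈ N G a ∩ B)
    neighbour {a} a∈A none = ℝ.rounded (value x) (0<⇒ {value x} (⟨0,1].0<value x)) λ (q , 0<q , q<x) →
      none (∣∣>0⁻ (ℕ.≰⇒> λ ∣N∣≤0 → ℕ.<⇒≱
        (ℕ.*-mono-≤ (ℕ.s≤s (ℕ.z≤n {proj₁ (↥-suc 0<q)})) (∣∣>0 B≢∅))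
        (ℕ.≤-trans (ι≤⇒ q (proj₂ (↥-suc 0<q)) (∣ B ∣) (∣ N G a ∩ B ∣)
                        (·≤⇒ (value x) (∣ B ∣) (∣ N G a ∩ B ∣) (A→B a∈A) q<x))
                   (ℕ.*-monoˡ-≤ (ℚ.↧ₙ q) ∣N∣≤0))))

    row : ∀ {a b} → a ∈ A → b ∈ N G a ∩ B → p ℚ.* ι ∣ C ∣ ℚ.≤ ι ∣ tabulate (e a) ∣
    row {a} {b} a∈A b∈ = ℚ.≤-trans
      (·≤⇒ (value y) (∣ C ∣) (∣ N G b ∩ C ∣) (B→C (proj₂ (x∈p∩q⁻ _ _ b∈))) p<y)
      (ι-mono (∣ N G b ∩ C ∣) (∣ tabulate (e a) ∣) (p⊆q⇒∣p∣≤∣q∣ λ {c} c∈ →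
        let c∈N , c∈C = x∈p∩q⁻ _ _ c∈ in
        ∈-tabulate⁺ (Equivalence.from T-∧
          ( does⁺ (c ∈? C) c∈C
          , does⁺ (a ∈? N² G c ∩ A) (x∈p∩q⁺
              (a∈N²c a∈A c∈C (∈-tabulate⁻ (proj₁ (x∈p∩q⁻ _ _ b∈))) (∈-tabulate⁻ c∈N) , a∈A))))))

    k : Vertex G → ℕ
    k v = ∣ N² G v ∩ A ∣

    v₀ = best C k C≢∅
    v  = proj₁ v₀

    col : ∀ {c} → c ∈ C → sum (λ a → ind (e a c)) ℕ.≤ k v
    col {c} c∈C = subst (ℕ._≤ k v) (∣tabulate∣ (λ a → e a c)) (ℕ.≤-trans
      (p⊆q⇒∣p∣≤∣q∣ λ {a} a∈ →
        does⁻ (a ∈? N² G c ∩ A) (proj₂ (Equivalence.to T-∧ (∈-tabulate⁻ a∈))))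
      (proj₂ (proj₂ v₀) c∈C))

    col-0 : ∀ {c} → c ∉ C → sum (λ a → ind (e a c)) ≡ 0
    col-0 {c} c∉C with c ∈? C
    ... | yes c∈C = contradiction c∈C c∉C
    ... | no  _   = zeros order
      where
      zeros : ∀ n → sum {n} (λ _ → 0) ≡ 0
      zeros zero    = refl
      zeros (suc n) = zeros n

    bound : p ℚ.* ι ∣ A ∣ ℚ.≤ ι (k v)
    bound = ι≤⇐ p ↥p≡n ∣ A ∣ (k v) goal
      where
      n = suc (proj₁ (↥-suc 0<p))
      ↥p≡n = proj₂ (↥-suc 0<p)
      d = ℚ.↧ₙ p
      rows : ∀ {a} → a ∈ A → n ℕ.* ∣ C ∣ ℕ.≤ sum (ind ∘ e a) ℕ.* d
      rows {a} a∈A = decidable-stable (_ ℕ.≤? _) λ ¬r → neighbour a∈A λ (b , b∈) →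
        ¬r (subst (λ s → n ℕ.* ∣ C ∣ ℕ.≤ s ℕ.* d) (∣tabulate∣ (e a))
          (ι≤⇒ p ↥p≡n (∣ C ∣) (∣ tabulate (e a) ∣) (row a∈A b∈)))
      instance
        ∣C∣≢0 : ℕ.NonZero ∣ C ∣
        ∣C∣≢0 = ℕ.>-nonZero (∣∣>0 C≢∅)
      open ℕ.≤-Reasoning
      goal : n ℕ.* ∣ A ∣ ℕ.≤ k v ℕ.* d
      goal = ℕ.*-cancelˡ-≤ ∣ C ∣ (begin
        ∣ C ∣ ℕ.* (n ℕ.* ∣ A ∣)                         ≡⟨ ℕ.*-assoc (∣ C ∣) n (∣ A ∣) ⟨
        ∣ C ∣ ℕ.* n ℕ.* ∣ A ∣                           ≡⟨ ℕ.*-comm (∣ C ∣ ℕ.* n) (∣ A ∣) ⟩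
        ∣ A ∣ ℕ.* (∣ C ∣ ℕ.* n)                         ≡⟨ cong (∣ A ∣ ℕ.*_) (ℕ.*-comm (∣ C ∣) n) ⟩
        ∣ A ∣ ℕ.* (n ℕ.* ∣ C ∣)                         ≤⟨ sum-lower A _ _ rows ⟩
        sum (λ a → sum (ind ∘ e a) ℕ.* d)           ≡⟨ sum-scale (λ a → sum (ind ∘ e a)) d ⟩
        sum (λ a → sum (λ c → ind (e a c))) ℕ.* d   ≡⟨ cong (ℕ._* d) (∑-comm (λ a c → ind (e a c))) ⟩
        sum (λ c → sum (λ a → ind (e a c))) ℕ.* d   ≤⟨ ℕ.*-monoˡ-≤ d (sum-upper C _ (k v) col col-0) ⟩
        ∣ C ∣ ℕ.* k v ℕ.* d                         ≡⟨ ℕ.*-assoc (∣ C ∣) (k v) d ⟩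
        ∣ C ∣ ℕ.* (k v ℕ.* d)                       ∎)

    result : ∃[ v ] v ∈ C × fromℕ (k v) ≥ fromℚ p · ∣ A ∣
    result = v , proj₁ (proj₂ v₀) , ·≤⇐ (fromℚ p) (∣ A ∣) (k v) λ q<p → ℚ.≤-trans
      (ℚ.*-monoʳ-≤-nonNeg (ι ∣ A ∣) {{ℚ.normalize-nonNeg ∣ A ∣ 1}} (ℚ.<⇒≤ q<p)) bound

  reaches-below-y : ∀ x y {p} → 0ℚ ℚ.< p → Below (value y) p → Reaches x y (fromℚ p)
  reaches-below-y x y 0<p p<y G A B C con = Averaging.result x y 0<p p<y G A B C con

  reaches-mono : ∀ {x y z w} → w ≤ z → Reaches x y z → Reaches x y w
  reaches-mono {z = z} {w} w≤z r G A B C con =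
    let v , v∈C , h = r G A B C con in v , v∈C , h ∘ ·-mono {w} {z} ∣ A ∣ w≤z

  sup : ⟨0,1] → ⟨0,1] → ℝ
  sup x y = record
    { Below     = λ q → ¬ ¬ (∃[ p ] q ℚ.< p × p ℚ.≤ 1ℚ × Reaches x y (fromℚ p))
    ; stable    = λ h k → h (λ h′ → h′ k)
    ; down      = λ q≤r h k → h λ (p , r<p , rest) → k (p , ℚ.≤-<-trans q≤r r<p , rest)
    ; rounded   = λ h k → h λ (p , q<p , rest) →
        let r , q<r , r<p = ℚ.<-dense q<p in k (r , q<r , λ k′ → k′ (p , r<p , rest))
    ; inhabited = 0ℚ , λ k → ℝ.rounded (value y) (0<⇒ {value y} (⟨0,1].0<value y)) λ (p , 0<p , p<y) →
        k (p , 0<p , ℚ.<⇒≤ (⟨0,1].value≤1 y p<y) , reaches-below-y x y 0<p p<y)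
    ; bounded   = 1ℚ , λ h → h λ (p , 1<p , p≤1 , _) → ℚ.<-irrefl refl (ℚ.<-≤-trans 1<p p≤1)
    }

φ-exists : ∀ x y → ∃ (IsMaximum (Reaches x y ∘ value))
φ-exists x y = z , attained , λ w r {q} q<w k →
  ℝ.rounded (value w) q<w λ (p , q<p , p<w) → k
    ( p , q<p , ℚ.<⇒≤ (⟨0,1].value≤1 w p<w)
    , reaches-mono {x} {y} {value w} {fromℚ p} (λ r<p → ℝ.down (value w) (ℚ.<⇒≤ r<p) p<w) r)
  where
  z : ⟨0,1]
  z = mk (sup x y)
    (λ z≤0 → ℚ.<-irrefl {0ℚ} refl (z≤0 (proj₂ (ℝ.inhabited (sup x y)))))
    (λ {q} h → decidable-stable (q ℚ.<? 1ℚ) λ q≮1 →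
      h λ (p , q<p , p≤1 , _) → q≮1 (ℚ.<-≤-trans q<p p≤1))

  attained : Reaches x y (sup x y)
  attained G A B C con =
    let k = λ v → ∣ N² G v ∩ A ∣
        v , v∈C , max = best C k (Tripartition.C≢∅ (Constrained.tripartition con))
    in v , v∈C , λ {q} h → decidable-stable (q ℚ.<? ι (k v)) λ q≮k →
      h λ (r , r<z , q<r∣A∣) → r<z λ (p , r<p , _ , reach) →
        let u , u∈C , g = reach G A B C con
        in q≮k (ℚ.<-≤-trans (g λ k → k (r , r<p , q<r∣A∣)) (ι-mono (k u) (k v) (max u∈C)))

φ : ⟨0,1] → ⟨0,1] → ⟨0,1]
φ x y = proj₁ (φ-exists x y)

φ-isMaximum : ∀ x y → IsMaximum (Reaches x y ∘ value) (φ x y)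
φ-isMaximum x y = proj₂ (φ-exists x y)

{-# OPTIONS --safe #-}

-- Writing D for the pairs in C × A that are not at distance two, the claim that
-- every vertex of C reaches less than z|A| vertices says that each c ∈ C has
-- D-degree more than (1 - z)|A|, and A → B → C → A has no triangle. So it suffices
-- to reverse such a cyclic system, keeping the three proportions. Replace sizes
-- by weights on A, B, C. If, say, no weighting of A gives every b ∈ B the required
-- proportion of A, then by Gordan's theorem there is a nonnegative vector on B
-- that falls short of the required proportion at every a ∈ A; subtracting the
-- right multiple of it from the weighting of B makes some b weightless, and this
-- b can be deleted. When no more deletions are possible all three relations can
-- be reversed, and blowing up the weights gives a graph again.
module Submission where

open import Data.Bool.Base using (Bool; true; false; T; not; _∧_; if_then_else_)
open import Data.Bool.Properties using (T-≡; ∧-zeroʳ; ∧-identityʳ)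
open import Data.Fin.Base as Fin using (Fin; zero; suc; _↑ˡ_; _↑ʳ_; splitAt; punchIn; punchOut)
import Data.Fin.Properties as Fin
open import Data.Fin.Subset using (Subset; _∈_; _∩_; _∪_; ∣_∣; Nonempty; Empty)
open import Data.Fin.Subset.Properties using (x∈p∩q⁺; x∈p∩q⁻; x∈p∪q⁺; ⊆-antisym; ⊆⊤)
open import Data.Integer.Base as ℤ using (ℤ)
import Data.Integer.Properties as ℤ
open import Data.Integer.Tactic.RingSolver using (solve-∀)
open import Data.Nat.Base as ℕ using (ℕ; zero; suc)
import Data.Nat.Properties as ℕ
open import Data.Nat.Tactic.RingSolver using () renaming (solve-∀ to ℕ-solve-∀)
open import Data.Product.Base using (∃; ∃-syntax; _×_; _,_; proj₁; proj₂)
import Data.Rational.Base as ℚ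
import Data.Rational.Properties as ℚ
open import Data.Rational.Unnormalised.Base as ℚᵘ using (mkℚᵘ; *≤*; *≡*)
import Data.Rational.Unnormalised.Properties as ℚᵘ
open import Data.Sum.Base using (_⊎_; inj₁; inj₂; [_,_]′)
import Data.Vec.Base as Vec
open import Data.Vec.Base using (tabulate; lookup; here; there)
open import Data.Vec.Functional using (Vector; _∷_; removeAt)
open import Data.Vec.Properties using (lookup∘tabulate; lookup-zipWith; []=⇒lookup; lookup⇒[]=)
open import Function.Base using (_∘_; flip; id)
open import Function.Bundles using (Equivalence)
open import Relation.Binary.PropositionalEquality
open import Relation.Nullary using (¬_; Dec; yes; no; does; contradiction)
open import Relation.Nullary.Decidable using (dec-true; dec-false)

-- Linear inequalities over the integers

module IntegerMatrices where
  open import Data.Integer.Base hiding (suc; negative)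
  open import Algebra.Properties.Semiring.Sum ℤ.+-*-semiring
    using (sum; sum-cong-≗; sum-remove; sum-replicate-zero; ∑-distrib-+; *-distribˡ-sum)

  private variable m n : ℕ

  *-nonNeg : ∀ {i j} → 0ℤ ≤ i → 0ℤ ≤ j → 0ℤ ≤ i * j
  *-nonNeg {+ i} {+ j} _ _ = subst (0ℤ ≤_) (ℤ.pos-* i j) (+≤+ ℕ.z≤n)

  *-pos : ∀ {i j} → 0ℤ < i → 0ℤ < j → 0ℤ < i * j
  *-pos { +[1+ i ]} { +[1+ j ]} _ _ = +<+ (ℕ.s≤s ℕ.z≤n)
  *-pos {+ zero}  (+<+ ())
  *-pos {+[1+ i ]} {+ zero} _ (+<+ ())

  square-nonNeg : ∀ i → 0ℤ ≤ i * i
  square-nonNeg (+ i)     = *-nonNeg (+≤+ {n = i} ℕ.z≤n) (+≤+ ℕ.z≤n)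
  square-nonNeg -[1+ i ]  = +≤+ ℕ.z≤n

  sum-nonNeg : (f : Vector ℤ n) → (∀ j → 0ℤ ≤ f j) → 0ℤ ≤ sum f
  sum-nonNeg {zero}  f f≥0 = ℤ.≤-refl
  sum-nonNeg {suc n} f f≥0 = ℤ.+-mono-≤ (f≥0 zero) (sum-nonNeg (f ∘ suc) (f≥0 ∘ suc))

  -- A probability distribution up to scaling. Leaving out the normalisation avoids division, so
  -- that weights can be integers and later become numbers of copies.
  Weighting : Vector ℤ n → Set
  Weighting w = (∀ j → 0ℤ ≤ w j) × ∃[ j ] 0ℤ < w j

  sum-pos : {f : Vector ℤ n} → Weighting f → 0ℤ < sum f
  sum-pos {suc n} {f} (f≥0 , j , fj>0) = subst (0ℤ <_) (sym (sum-remove {i = j} f))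
    (ℤ.+-mono-<-≤ fj>0 (sum-nonNeg (removeAt f j) (f≥0 ∘ punchIn j)))

  infix 8 _∙_

  _∙_ : Vector ℤ n → Vector ℤ n → ℤ
  f ∙ g = sum λ j → f j * g j

  ∙-comm : (f g : Vector ℤ n) → f ∙ g ≡ g ∙ f
  ∙-comm f g = sum-cong-≗ λ j → ℤ.*-comm (f j) (g j)

  ∙-congʳ : ∀ (f : Vector ℤ n) {g h} → (∀ j → g j ≡ h j) → f ∙ g ≡ f ∙ h
  ∙-congʳ f g≗h = sum-cong-≗ λ j → cong (f j *_) (g≗h j)

  ∙-linearʳ : ∀ (f : Vector ℤ n) a g b h →
              f ∙ (λ j → a * g j + b * h j) ≡ a * f ∙ g + b * f ∙ h
  ∙-linearʳ f a g b h = begin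
    sum (λ j → f j * (a * g j + b * h j))         ≡⟨ sum-cong-≗ (λ j → distrib (f j) a (g j) b (h j)) ⟩
    sum (λ j → a * (f j * g j) + b * (f j * h j))
      ≡⟨ ∑-distrib-+ (λ j → a * (f j * g j)) (λ j → b * (f j * h j)) ⟩
    sum (λ j → a * (f j * g j)) + sum (λ j → b * (f j * h j))
      ≡⟨ cong₂ _+_ (*-distribˡ-sum a (λ j → f j * g j)) (*-distribˡ-sum b (λ j → f j * h j)) ⟨
    a * f ∙ g + b * f ∙ h                         ∎
    where
    open ≡-Reasoning
    distrib : ∀ f a g b h → f * (a * g + b * h) ≡ a * (f * g) + b * (f * h)
    distrib = solve-∀

  ∙-linearˡ : ∀ a f b g (h : Vector ℤ n) →
              (λ j → a * f j + b * g j) ∙ h ≡ a * f ∙ h + b * g ∙ h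
  ∙-linearˡ a f b g h = begin
    (λ j → a * f j + b * g j) ∙ h ≡⟨ ∙-comm _ h ⟩
    h ∙ (λ j → a * f j + b * g j) ≡⟨ ∙-linearʳ h a f b g ⟩
    a * h ∙ f + b * h ∙ g         ≡⟨ cong₂ (λ s t → a * s + b * t) (∙-comm h f) (∙-comm h g) ⟩
    a * f ∙ h + b * g ∙ h         ∎
    where open ≡-Reasoning

  ∙-scaleˡ : ∀ a (f g : Vector ℤ n) → (λ j → a * f j) ∙ g ≡ a * f ∙ g
  ∙-scaleˡ a f g = trans (sum-cong-≗ λ j → ℤ.*-assoc a (f j) (g j)) (sym (*-distribˡ-sum a (λ j → f j * g j)))

  ∙-zeroˡ : ∀ (f g : Vector ℤ n) → (∀ j → f j ≡ 0ℤ) → f ∙ g ≡ 0ℤ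
  ∙-zeroˡ {n} f g f≡0 =
    trans (sum-cong-≗ λ j → trans (cong (_* g j) (f≡0 j)) (ℤ.*-zeroˡ (g j))) (sum-replicate-zero n)

  ∙-zeroʳ : ∀ (f g : Vector ℤ n) → (∀ j → g j ≡ 0ℤ) → f ∙ g ≡ 0ℤ
  ∙-zeroʳ f g g≡0 = trans (∙-comm f g) (∙-zeroˡ g f g≡0)

  ∙-remove : ∀ (f g : Vector ℤ (suc n)) j → g j ≡ 0ℤ → f ∙ g ≡ removeAt f j ∙ removeAt g j
  ∙-remove f g j gj≡0 = begin
    f ∙ g                                   ≡⟨ sum-remove {i = j} (λ k → f k * g k) ⟩
    f j * g j + removeAt f j ∙ removeAt g j ≡⟨ cong (λ t → f j * t + removeAt f j ∙ removeAt g j) gj≡0 ⟩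
    f j * 0ℤ + removeAt f j ∙ removeAt g j  ≡⟨ cong (_+ removeAt f j ∙ removeAt g j) (ℤ.*-zeroʳ (f j)) ⟩
    0ℤ + removeAt f j ∙ removeAt g j        ≡⟨ ℤ.+-identityˡ _ ⟩
    removeAt f j ∙ removeAt g j             ∎
    where open ≡-Reasoning

  ∙-self-pos : ∀ (l : Vector ℤ n) → ¬ (∀ j → l j ≡ 0ℤ) → 0ℤ < l ∙ l
  ∙-self-pos l l≢0 = sum-pos (square-nonNeg ∘ l , j , ℤ.≤∧≢⇒< (square-nonNeg (l j)) square≢0)
    where
    nonzero = Fin.¬∀⟶∃¬ _ (λ j → l j ≡ 0ℤ) (λ j → l j ℤ.≟ 0ℤ) l≢0
    j = proj₁ nonzero
    square≢0 : 0ℤ ≢ l j * l j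
    square≢0 eq = proj₂ nonzero ([ id , id ]′ (ℤ.i*j≡0⇒i≡0∨j≡0 (l j) (sym eq)))

  -- Supplies the multiplier in the last case of `gordan`; it is nonnegative so that multiplying by
  -- it preserves inequalities.
  strict-bound : (f : Vector ℤ n) → ∃[ k ] 0ℤ ≤ k × (∀ i → f i < k)
  strict-bound {zero}  f = 0ℤ , ℤ.≤-refl , λ ()
  strict-bound {suc n} f =
    let k , k≥0 , f<k = strict-bound (f ∘ suc) in
    k ⊔ (f zero ⊔ 0ℤ + 1ℤ) ,
    ℤ.≤-trans k≥0 (ℤ.i≤i⊔j k _) ,
    λ { zero    → ℤ.<-≤-trans (ℤ.≤-<-trans (ℤ.i≤i⊔j (f zero) 0ℤ) (i<i+1 _)) (ℤ.i≤j⊔i k _)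
      ; (suc i) → ℤ.<-≤-trans (f<k i) (ℤ.i≤i⊔j k _) }
    where
    i<i+1 : ∀ i → i < i + 1ℤ
    i<i+1 i = subst (_< i + 1ℤ) (ℤ.+-identityʳ i) (ℤ.+-monoʳ-< i (+<+ (ℕ.s≤s ℕ.z≤n)))

  -- Induction on the number of rows: if v makes every row but l negative and
  -- l ∙ v is nonnegative, project the other rows along l, so that they vanish on v.
  gordan : (L : Fin m → Vector ℤ n) →
           (∃[ v ] ∀ i → L i ∙ v < 0ℤ) ⊎
           (∃[ u ] Weighting u × ∀ j → u ∙ flip L j ≡ 0ℤ)
  gordan {zero}      L = inj₁ ((λ _ → 0ℤ) , λ ())
  gordan {suc m} {n} L with gordan (L ∘ suc)
  ... | inj₂ (u , (u≥0 , i , ui>0) , uL≡0) =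
    inj₂ (0ℤ ∷ u , ((λ { zero → ℤ.≤-refl ; (suc i) → u≥0 i }) , suc i , ui>0) ,
      λ j → cong₂ _+_ (ℤ.*-zeroˡ (L zero j)) (uL≡0 j))
  ... | inj₁ (v , Lv<0) with L zero ∙ v ℤ.<? 0ℤ | Fin.all? (λ j → L zero j ℤ.≟ 0ℤ)
  ...   | yes lv<0 | _       = inj₁ (v , λ { zero → lv<0 ; (suc i) → Lv<0 i })
  ...   | no  _    | yes l≡0 =
    inj₂ (1ℤ ∷ (λ _ → 0ℤ) , ((λ { zero → +≤+ ℕ.z≤n ; (suc i) → ℤ.≤-refl }) , zero , +<+ (ℕ.s≤s ℕ.z≤n)) ,
      λ j → cong₂ _+_ (trans (ℤ.*-identityˡ _) (l≡0 j)) (∙-zeroˡ (λ _ → 0ℤ) (λ i → L (suc i) j) λ _ → refl))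
  ...   | no  lv≮0 | no  l≢0 with gordan (λ i j → L zero ∙ v * L (suc i) j + - (L (suc i) ∙ v) * L zero j)
  ...     | inj₂ (u , (u≥0 , i , ui>0) , uL′≡0) =
    -- Expanding the projected rows turns the dependency `u` into one with coefficient `u ∙ d` on
    -- `L zero` and `c * u i` on `L (suc i)`. Positivity is witnessed at `L zero`, since `c` may
    -- vanish.
    inj₂ (u ∙ d ∷ (λ i → c * u i) ,
      ( (λ { zero → ℤ.<⇒≤ ud>0 ; (suc i) → *-nonNeg (ℤ.≮⇒≥ lv≮0) (u≥0 i) }) , zero , ud>0) ,
      λ j → trans (regroup j) (uL′≡0 j))
    where
    c = L zero ∙ v
    d : Vector ℤ m
    d i = - (L (suc i) ∙ v)
    d>0 : ∀ i → 0ℤ < d i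
    d>0 i = ℤ.neg-mono-< (Lv<0 i)
    ud>0 : 0ℤ < u ∙ d
    ud>0 = sum-pos ((λ i → *-nonNeg (u≥0 i) (ℤ.<⇒≤ (d>0 i))) , i , *-pos ui>0 (d>0 i))
    regroup : ∀ j → u ∙ d * L zero j + (λ i → c * u i) ∙ (λ i → L (suc i) j) ≡
                    u ∙ (λ i → c * L (suc i) j + d i * L zero j)
    regroup j = begin
      u ∙ d * l + (λ i → c * u i) ∙ K ≡⟨ cong₂ _+_ (ℤ.*-comm (u ∙ d) l) (∙-scaleˡ c u K) ⟩
      l * u ∙ d + c * u ∙ K           ≡⟨ ℤ.+-comm (l * u ∙ d) (c * u ∙ K) ⟩
      c * u ∙ K + l * u ∙ d           ≡⟨ ∙-linearʳ u c K l d ⟨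
      u ∙ (λ i → c * K i + l * d i)
        ≡⟨ sum-cong-≗ (λ i → cong (λ t → u i * (c * K i + t)) (ℤ.*-comm l (d i))) ⟩
      u ∙ (λ i → c * K i + d i * l)   ∎
      where
      open ≡-Reasoning
      l = L zero j
      K = λ i → L (suc i) j
  ...     | inj₁ (v′ , L′v′<0) = inj₁ (v‴ , λ { zero → negative₀ ; (suc i) → negative i })
    where
    l = L zero
    c = l ∙ v
    e = l ∙ v′
    -- The same projection seen from the vectors: `v″` is orthogonal to `l`, and `L (suc i)` takes
    -- on `v″` the value of the projected row on `v′`.
    v″ : Vector ℤ n
    v″ j = c * v′ j + - e * v j
    lv″≡0 : l ∙ v″ ≡ 0ℤ
    lv″≡0 = trans (∙-linearʳ l c v′ (- e) v) (cancel c e)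
      where
      cancel : ∀ c e → c * e + - e * c ≡ 0ℤ
      cancel = solve-∀
    Lv″<0 : ∀ i → L (suc i) ∙ v″ < 0ℤ
    Lv″<0 i = subst (_< 0ℤ) (begin
      (λ j → c * K j + - (K ∙ v) * l j) ∙ v′ ≡⟨ ∙-linearˡ c K (- (K ∙ v)) l v′ ⟩
      c * K ∙ v′ + - (K ∙ v) * e             ≡⟨ cong (_+_ (c * K ∙ v′)) (swap (K ∙ v) e) ⟩
      c * K ∙ v′ + - e * K ∙ v               ≡⟨ ∙-linearʳ K c v′ (- e) v ⟨
      K ∙ v″                                 ∎) (L′v′<0 i)
      where
      open ≡-Reasoning
      K = L (suc i)
      swap : ∀ s t → - s * t ≡ - t * s
      swap = solve-∀
    bound = strict-bound λ i → - (L (suc i) ∙ l)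
    k   = proj₁ bound
    k≥0 = proj₁ (proj₂ bound)
    -- Stepping against `l` makes the first row negative. The other rows take negative integer
    -- values on `v″`, hence at most `-1ℤ`, so `k` copies of `v″` outweigh the change.
    v‴ : Vector ℤ n
    v‴ j = k * v″ j + -1ℤ * l j
    negative₀ : l ∙ v‴ < 0ℤ
    negative₀ = subst (_< 0ℤ) (sym (begin
      l ∙ v‴                   ≡⟨ ∙-linearʳ l k v″ -1ℤ l ⟩
      k * l ∙ v″ + -1ℤ * l ∙ l ≡⟨ cong (λ t → k * t + -1ℤ * l ∙ l) lv″≡0 ⟩
      k * 0ℤ + -1ℤ * l ∙ l     ≡⟨ simplify k (l ∙ l) ⟩
      - (l ∙ l)                ∎)) (ℤ.neg-mono-< (∙-self-pos l l≢0))
      where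
      open ≡-Reasoning
      simplify : ∀ k s → k * 0ℤ + -1ℤ * s ≡ - s
      simplify = solve-∀
    negative : ∀ i → L (suc i) ∙ v‴ < 0ℤ
    negative i = begin-strict
      K ∙ v‴                   ≡⟨ ∙-linearʳ K k v″ -1ℤ l ⟩
      k * K ∙ v″ + -1ℤ * K ∙ l ≤⟨ ℤ.+-monoˡ-≤ (-1ℤ * K ∙ l)
        (ℤ.*-monoˡ-≤-nonNeg k {{nonNegative k≥0}} (ℤ.i<j⇒i≤pred[j] (Lv″<0 i))) ⟩
      k * -1ℤ + -1ℤ * K ∙ l    ≡⟨ simplify k (K ∙ l) ⟩
      - k + - (K ∙ l)          <⟨ ℤ.+-monoʳ-< (- k) (proj₂ (proj₂ bound) i) ⟩
      - k + k                  ≡⟨ ℤ.+-inverseˡ k ⟩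
      0ℤ                       ∎
      where
      open ℤ.≤-Reasoning
      K = L (suc i)
      simplify : ∀ k s → k * -1ℤ + -1ℤ * s ≡ - k + - s
      simplify = solve-∀

  positive-entry : ∀ (f w : Vector ℤ n) → (∀ j → 0ℤ ≤ w j) → f ∙ w ≢ 0ℤ → ∃[ j ] 0ℤ < w j
  positive-entry f w w≥0 fw≢0 with Fin.any? (λ j → 0ℤ ℤ.<? w j)
  ... | yes found = found
  ... | no  none  = contradiction
    (∙-zeroʳ f w λ j → ℤ.≤-antisym (ℤ.≮⇒≥ λ wj>0 → none (j , wj>0)) (w≥0 j)) fw≢0

  -unit : Fin n → Vector ℤ n
  -unit j k = if does (j Fin.≟ k) then -1ℤ else 0ℤ

  -unit-sym : (j k : Fin n) → -unit j k ≡ -unit k j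
  -unit-sym j k with j Fin.≟ k
  ... | yes refl rewrite dec-true (j Fin.≟ j) refl = refl
  ... | no  j≢k  rewrite dec-false (k Fin.≟ j) (j≢k ∘ sym) = refl

  -unit-∙ : ∀ j (w : Vector ℤ n) → -unit j ∙ w ≡ - w j
  -unit-∙ {suc n} j w = begin
    -unit j ∙ w                                           ≡⟨ sum-remove {i = j} (λ k → -unit j k * w k) ⟩
    -unit j j * w j + removeAt (-unit j) j ∙ removeAt w j ≡⟨ cong₂ _+_ (cong (_* w j) diagonal)
      (∙-zeroˡ (removeAt (-unit j) j) (removeAt w j) off-diagonal) ⟩
    -1ℤ * w j + 0ℤ                                        ≡⟨ ℤ.+-identityʳ _ ⟩
    -1ℤ * w j                                             ≡⟨ ℤ.-1*i≡-i (w j) ⟩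
    - w j                                                 ∎
    where
    open ≡-Reasoning
    diagonal : -unit j j ≡ -1ℤ
    diagonal rewrite dec-true (j Fin.≟ j) refl = refl
    off-diagonal : ∀ k → -unit j (punchIn j k) ≡ 0ℤ
    off-diagonal k rewrite dec-false (j Fin.≟ punchIn j k) (Fin.punchInᵢ≢i j k ∘ sym) = refl

  sum-splitAt : ∀ m (f : Vector ℤ (m ℕ.+ n)) →
                sum f ≡ sum (λ i → f (i ↑ˡ n)) + sum (λ j → f (m ↑ʳ j))
  sum-splitAt zero    f = sym (ℤ.+-identityˡ _)
  sum-splitAt (suc m) f = trans (cong (_+_ (f zero)) (sum-splitAt m (f ∘ suc))) (sym (ℤ.+-assoc (f zero) _ _))

  -- Feasibility of a system and of its transpose

  Feasible : (Fin m → Vector ℤ n) → Set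
  Feasible M = ∃[ w ] Weighting w × ∀ i → 0ℤ ≤ M i ∙ w

  -- Gordan's theorem for the rows of M together with the rows of -I.
  ville : (M : Fin m → Vector ℤ n) →
          (∃[ w ] (∀ j → 0ℤ ≤ w j) × ∀ i → M i ∙ w < 0ℤ) ⊎ Feasible (flip M)
  ville {m} {n} M with gordan ([ M , -unit ]′ ∘ splitAt m)
  ... | inj₁ (v , neg) = inj₁ (v , v≥0 , row)
    where
    v≥0 : ∀ j → 0ℤ ≤ v j
    v≥0 j = ℤ.<⇒≤ (ℤ.neg-cancel-< (subst (_< 0ℤ) (-unit-∙ j v)
      (subst (λ s → [ M , -unit ]′ s ∙ v < 0ℤ) (Fin.splitAt-↑ʳ m n j) (neg (m ↑ʳ j)))))
    row : ∀ i → M i ∙ v < 0ℤ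
    row i = subst (λ s → [ M , -unit ]′ s ∙ v < 0ℤ) (Fin.splitAt-↑ˡ m i n) (neg (i ↑ˡ n))
  ... | inj₂ (u , (u≥0 , i , ui>0) , uL≡0) = inj₂ (u₁ , (u≥0 ∘ (_↑ˡ n) , u₁-positive) , column-nonNeg)
    where
    u₁ : Vector ℤ m
    u₁ i = u (i ↑ˡ n)
    u₂ : Vector ℤ n
    u₂ j = u (m ↑ʳ j)
    -- In the dependency, the coefficients `u₂` of the rows of `-I` are the slacks of the column
    -- inequalities at `u₁`.
    column : ∀ j → flip M j ∙ u₁ ≡ u₂ j
    column j = ℤ.i-j≡0⇒i≡j _ _ (begin
      flip M j ∙ u₁ + - u₂ j                        ≡⟨ cong₂ _+_ (∙-comm (flip M j) u₁) (sym (-unit-∙ j u₂)) ⟩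
      u₁ ∙ flip M j + -unit j ∙ u₂                  ≡⟨ cong₂ _+_
        (sum-cong-≗ λ i → cong (λ s → u₁ i * [ M , -unit ]′ s j) (sym (Fin.splitAt-↑ˡ m i n)))
        (trans (∙-comm (-unit j) u₂) (sum-cong-≗ λ k → cong (u₂ k *_) (trans (-unit-sym j k)
          (cong (λ s → [ M , -unit ]′ s j) (sym (Fin.splitAt-↑ʳ m n k)))))) ⟩
      _                                             ≡⟨ sum-splitAt m (λ k → u k * [ M , -unit ]′ (splitAt m k) j) ⟨
      u ∙ (λ k → [ M , -unit ]′ (splitAt m k) j)    ≡⟨ uL≡0 j ⟩
      0ℤ                                            ∎)
      where open ≡-Reasoning
    column-nonNeg : ∀ j → 0ℤ ≤ flip M j ∙ u₁
    column-nonNeg j = subst (0ℤ ≤_) (sym (column j)) (u≥0 (m ↑ʳ j))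
    u₁-positive : ∃[ i ] 0ℤ < u₁ i
    u₁-positive with splitAt m i in eq
    ... | inj₁ i₁ = i₁ , subst (λ k → 0ℤ < u k) (sym (Fin.splitAt⁻¹-↑ˡ eq)) ui>0
    -- A positive slack is a nonzero value of a column on `u₁`, so `u₁` cannot vanish.
    ... | inj₂ j  = positive-entry (flip M j) u₁ (u≥0 ∘ (_↑ˡ n)) λ eq′ →
      ℤ.<-irrefl (sym (trans (sym (column j)) eq′))
        (subst (λ k → 0ℤ < u k) (sym (Fin.splitAt⁻¹-↑ʳ {m} eq)) ui>0)

  *-nonPos : ∀ {i j} → 0ℤ ≤ i → j ≤ 0ℤ → i * j ≤ 0ℤ
  *-nonPos {i} {j} i≥0 j≤0 =
    subst (i * j ≤_) (ℤ.*-zeroʳ i) (ℤ.*-monoˡ-≤-nonNeg i {{nonNegative i≥0}} j≤0)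

  -- The ratio test of the simplex method: among the entries with `g` positive, `j` minimises
  -- `f / g`, written with cross-multiplication. Where `g k` is not positive, the inequality holds
  -- by signs, `f` being nonnegative.
  minimal-ratio : ∀ (f g : Vector ℤ n) → (∀ j → 0ℤ ≤ f j) → (∃[ j ] 0ℤ < g j) →
                  ∃[ j ] 0ℤ < g j × (∀ k → f j * g k ≤ f k * g j)
  minimal-ratio {suc n} f g f≥0 (j₀ , gj₀>0) with Fin.any? (λ j → 0ℤ ℤ.<? g (suc j))
  ... | no none = zero , g₀>0 , λ
    { zero    → ℤ.≤-refl
    ; (suc k) → ℤ.≤-trans (*-nonPos (f≥0 zero) (ℤ.≮⇒≥ λ gk>0 → none (k , gk>0)))
                          (*-nonNeg (f≥0 (suc k)) (ℤ.<⇒≤ g₀>0)) }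
    where
    first : ∀ j → 0ℤ < g j → 0ℤ < g zero
    first zero    gj>0 = gj>0
    first (suc j) gj>0 = contradiction (j , gj>0) none
    g₀>0 = first j₀ gj₀>0
  ... | yes some with minimal-ratio (f ∘ suc) (g ∘ suc) (f≥0 ∘ suc) some
  ...   | j , gj>0 , min with f (suc j) * g zero ℤ.≤? f zero * g (suc j)
  ...     | yes fj≤f₀ = suc j , gj>0 , λ { zero → fj≤f₀ ; (suc k) → min k }
  ...     | no  fj≰f₀ = zero , g₀>0 , λ { zero → ℤ.≤-refl ; (suc k) → compare k }
    where
    f₀<fj : f zero * g (suc j) < f (suc j) * g zero
    f₀<fj = ℤ.≰⇒> fj≰f₀
    g₀>0 : 0ℤ < g zero
    g₀>0 = ℤ.*-cancelˡ-<-nonNeg (f (suc j)) {{nonNegative (f≥0 (suc j))}}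
      (ℤ.≤-<-trans (subst (_≤ f zero * g (suc j)) (sym (ℤ.*-zeroʳ (f (suc j))))
        (*-nonNeg (f≥0 zero) (ℤ.<⇒≤ gj>0))) f₀<fj)
    rotate : ∀ x y z → x * y * z ≡ x * z * y
    rotate = solve-∀
    compare : ∀ k → f zero * g (suc k) ≤ f (suc k) * g zero
    compare k with ℤ.≤-total 0ℤ (g (suc k))
    ... | inj₂ gk≤0 = ℤ.≤-trans
      (*-nonPos (f≥0 zero) gk≤0) (*-nonNeg (f≥0 (suc k)) (ℤ.<⇒≤ g₀>0))
    ... | inj₁ gk≥0 = ℤ.*-cancelʳ-≤-pos _ _ (g (suc j)) {{positive gj>0}} (begin
      f zero * g (suc k) * g (suc j)    ≡⟨ rotate (f zero) _ _ ⟩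
      f zero * g (suc j) * g (suc k)    ≤⟨ ℤ.*-monoʳ-≤-nonNeg (g (suc k)) {{nonNegative gk≥0}} (ℤ.<⇒≤ f₀<fj) ⟩
      f (suc j) * g zero * g (suc k)    ≡⟨ rotate (f (suc j)) _ _ ⟩
      f (suc j) * g (suc k) * g zero    ≤⟨ ℤ.*-monoʳ-≤-nonNeg (g zero) {{nonNegative (ℤ.<⇒≤ g₀>0)}} (min k) ⟩
      f (suc k) * g (suc j) * g zero    ≡⟨ rotate (f (suc k)) _ _ ⟩
      f (suc k) * g zero * g (suc j)    ∎)
      where open ℤ.≤-Reasoning

  drop-column : ∀ (M : Fin m → Vector ℤ (suc n)) (feas : Feasible M) j → proj₁ feas j ≡ 0ℤ →
                Feasible (λ i → removeAt (M i) j)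
  drop-column M (w , (w≥0 , k , wk>0) , Mw≥0) j wj≡0 =
    removeAt w j ,
    (w≥0 ∘ punchIn j , punchOut j≢k , subst (λ l → 0ℤ < w l) (sym (Fin.punchIn-punchOut j≢k)) wk>0) ,
    λ i → subst (0ℤ ≤_) (∙-remove (M i) w j wj≡0) (Mw≥0 i)
    where
    j≢k : j ≢ k
    j≢k refl = ℤ.<-irrefl (sym wj≡0) wk>0

  -- If Mᵀ is infeasible, some w ≥ 0 makes all entries of M w negative, and
  -- subtracting w from a feasible weighting until an entry vanishes keeps it feasible.
  transpose-or-drop : (M : Fin m → Vector ℤ (suc n)) → Fin m → Feasible M →
                      Feasible (flip M) ⊎ ∃[ j ] Feasible (λ i → removeAt (M i) j)
  transpose-or-drop {m} {n} M i₀ feas@(w , (w≥0 , _) , Mw≥0) with ville M | Fin.any? (λ j → w j ℤ.≟ 0ℤ)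
  ... | inj₂ flipped | _              = inj₁ flipped
  ... | inj₁ _       | yes (j , wj≡0) = inj₂ (j , drop-column M feas j wj≡0)
  ... | inj₁ (w⁻ , w⁻≥0 , Mw⁻<0) | no w≢0 =
    inj₂ (j , drop-column M (w′ , (w′≥0 , w′>0) , ℤ.<⇒≤ ∘ Mw′>0) j w′j≡0)
    where
    -- Row `i₀` is negative on `w⁻`, so `w⁻` has a positive entry and the ratio test applies.
    ratio = minimal-ratio w w⁻ w≥0 (positive-entry (M i₀) w⁻ w⁻≥0 (λ eq → ℤ.<-irrefl eq (Mw⁻<0 i₀)))
    j     = proj₁ ratio
    w⁻j>0 = proj₁ (proj₂ ratio)
    wj>0 : 0ℤ < w j
    wj>0 = ℤ.≤∧≢⇒< (w≥0 j) λ 0≡wj → w≢0 (j , sym 0≡wj)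
    -- Up to the factor `w⁻ j`, which keeps it integral, this subtracts from `w` the largest
    -- multiple of `w⁻` that leaves all entries nonnegative; entry `j` becomes zero.
    w′ : Vector ℤ (suc n)
    w′ k = w⁻ j * w k + - w j * w⁻ k
    w′≥0 : ∀ k → 0ℤ ≤ w′ k
    w′≥0 k = subst (0ℤ ≤_) (rearrange (w k) (w⁻ j) (w j) (w⁻ k)) (ℤ.i≤j⇒0≤j-i (proj₂ (proj₂ ratio) k))
      where
      rearrange : ∀ p q r s → p * q - r * s ≡ q * p + - r * s
      rearrange = solve-∀
    w′j≡0 : w′ j ≡ 0ℤ
    w′j≡0 = cancel (w j) (w⁻ j)
      where
      cancel : ∀ p q → q * p + - p * q ≡ 0ℤ
      cancel = solve-∀
    -- Strictness, which rests on `w j` being positive, ensures that `w′` is not the zero vector;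
    -- this is why weightings with a zero entry are treated before.
    Mw′>0 : ∀ i → 0ℤ < M i ∙ w′
    Mw′>0 i = subst (0ℤ <_) (sym (∙-linearʳ (M i) (w⁻ j) w (- w j) w⁻))
      (ℤ.+-mono-≤-< (*-nonNeg (ℤ.<⇒≤ w⁻j>0) (Mw≥0 i)) (subst (0ℤ <_) (neg-swap (w j) (M i ∙ w⁻))
        (*-pos wj>0 (ℤ.neg-mono-< (Mw⁻<0 i)))))
      where
      neg-swap : ∀ p q → p * - q ≡ - p * q
      neg-swap = solve-∀
    w′>0 : ∃[ k ] 0ℤ < w′ k
    w′>0 = positive-entry (M i₀) w′ w′≥0 (λ eq → ℤ.<-irrefl (sym eq) (Mw′>0 i₀))

  -- The maps send the indices that survive deletion to the original ones. A cycle of relations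
  -- without triangles stays so when pulled back along them.
  record TransposeFeasible {a b c} (M : Fin a → Vector ℤ b) (N : Fin b → Vector ℤ c)
                           (P : Fin c → Vector ℤ a) : Set where
    field
      {a′ b′ c′} : ℕ
      f : Fin a′ → Fin a
      g : Fin b′ → Fin b
      h : Fin c′ → Fin c
      Mᵀ : Feasible λ j i → M (f i) (g j)
      Nᵀ : Feasible λ k j → N (g j) (h k)
      Pᵀ : Feasible λ i k → P (h k) (f i)

  -- Deleting a column of one matrix deletes the corresponding row of the next, which only removes
  -- inequalities, and leaves the third alone. Hence all three stay feasible while the sizes drop.
  -- An empty index set cannot occur, as it carries no weighting.
  transpose-cycle : ∀ {a b c} (M : Fin a → Vector ℤ b) (N : Fin b → Vector ℤ c) (P : Fin c → Vector ℤ a) →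
                    Feasible M → Feasible N → Feasible P → TransposeFeasible M N P
  transpose-cycle {a = zero} M N P _ _ (_ , (_ , () , _) , _)
  transpose-cycle {b = zero} M N P (_ , (_ , () , _) , _) _ _
  transpose-cycle {c = zero} M N P _ (_ , (_ , () , _) , _) _
  transpose-cycle {suc a} {suc b} {suc c} M N P FM FN FP
    with transpose-or-drop M zero FM | transpose-or-drop N zero FN | transpose-or-drop P zero FP
  ... | inj₁ Mᵀ | inj₁ Nᵀ | inj₁ Pᵀ = record { f = id ; g = id ; h = id ; Mᵀ = Mᵀ ; Nᵀ = Nᵀ ; Pᵀ = Pᵀ }
  ... | inj₂ (j , FM′) | _ | _ =
    let w , w-pos , Nw≥0 = FN
        open TransposeFeasible (transpose-cycle (λ i → removeAt (M i) j) (removeAt N j) P FM′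
          (w , w-pos , Nw≥0 ∘ punchIn j) FP)
    in record { f = f ; g = punchIn j ∘ g ; h = h ; Mᵀ = Mᵀ ; Nᵀ = Nᵀ ; Pᵀ = Pᵀ }
  ... | _ | inj₂ (k , FN′) | _ =
    let w , w-pos , Pw≥0 = FP
        open TransposeFeasible (transpose-cycle M (λ j → removeAt (N j) k) (removeAt P k) FM FN′
          (w , w-pos , Pw≥0 ∘ punchIn k))
    in record { f = f ; g = g ; h = punchIn k ∘ h ; Mᵀ = Mᵀ ; Nᵀ = Nᵀ ; Pᵀ = Pᵀ }
  ... | _ | _ | inj₂ (i , FP′) =
    let w , w-pos , Mw≥0 = FM
        open TransposeFeasible (transpose-cycle (removeAt M i) N (λ k → removeAt (P k) i)
          (w , w-pos , Mw≥0 ∘ punchIn i) FN FP′)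
    in record { f = punchIn i ∘ f ; g = g ; h = h ; Mᵀ = Mᵀ ; Nᵀ = Nᵀ ; Pᵀ = Pᵀ }

open IntegerMatrices using (Feasible; TransposeFeasible; transpose-cycle)

open import Algebra.Properties.CommutativeMonoid.Sum ℕ.+-0-commutativeMonoid
  using (sum; sum-cong-≗)
open import Data.Nat.Base using (_+_; _*_; _∸_)
open import Defs

private variable m n : ℕ

-- Counting

indicator : Bool → ℕ
indicator true  = 1
indicator false = 0

count : (Fin n → Bool) → ℕ
count r = sum (indicator ∘ r)

count-cong : {r s : Fin n → Bool} → (∀ i → r i ≡ s i) → count r ≡ count s
count-cong r≗s = sum-cong-≗ (cong indicator ∘ r≗s)

count-true : ∀ n → count {n} (λ _ → true) ≡ n
count-true zero    = refl
count-true (suc n) = cong suc (count-true n)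

count-false : ∀ n → count {n} (λ _ → false) ≡ 0
count-false zero    = refl
count-false (suc n) = count-false n

count≤n : (r : Fin n → Bool) → count r ℕ.≤ n
count≤n {zero}  r = ℕ.z≤n
count≤n {suc n} r with r zero
... | true  = ℕ.s≤s (count≤n (r ∘ suc))
... | false = ℕ.m≤n⇒m≤1+n (count≤n (r ∘ suc))

count-not : (r : Fin n → Bool) → count r + count (not ∘ r) ≡ n
count-not {zero}  r = refl
count-not {suc n} r with r zero
... | true  = cong suc (count-not (r ∘ suc))
... | false = trans (ℕ.+-suc _ _) (cong suc (count-not (r ∘ suc)))

count-disjoint : (r s : Fin n → Bool) → (∀ i → T (r i) → ¬ T (s i)) → count r + count s ℕ.≤ n
count-disjoint {zero}  r s disj = ℕ.z≤n
count-disjoint {suc n} r s disj with r zero | s zero | disj zero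
... | true  | true  | d = contradiction _ (d _)
... | true  | false | _ = ℕ.s≤s (count-disjoint (r ∘ suc) (s ∘ suc) (disj ∘ suc))
... | false | true  | _ = ℕ.≤-trans (ℕ.≤-reflexive (ℕ.+-suc _ _))
  (ℕ.s≤s (count-disjoint (r ∘ suc) (s ∘ suc) (disj ∘ suc)))
... | false | false | _ = ℕ.m≤n⇒m≤1+n (count-disjoint (r ∘ suc) (s ∘ suc) (disj ∘ suc))

count-splitAt : ∀ m (r : Fin (m + n) → Bool) →
                count r ≡ count (λ i → r (i ↑ˡ n)) + count (λ j → r (m ↑ʳ j))
count-splitAt zero    r = refl
count-splitAt (suc m) r =
  trans (cong (indicator (r zero) +_) (count-splitAt m (r ∘ suc)))
    (sym (ℕ.+-assoc (indicator (r zero)) _ _))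

minimum : (f : Fin n → ℕ) → Fin n → ∃[ i ] ∀ j → f i ℕ.≤ f j
minimum {suc zero}    f _ = zero , λ { zero → ℕ.≤-refl }
minimum {suc (suc n)} f _ with minimum (f ∘ suc) zero
... | i , min with ℕ.≤-total (f zero) (f (suc i))
...   | inj₁ f₀≤fi = zero  , λ { zero → ℕ.≤-refl ; (suc j) → ℕ.≤-trans f₀≤fi (min j) }
...   | inj₂ fi≤f₀ = suc i , λ { zero → fi≤f₀ ; (suc j) → min j }

-- The projection to the originals from a set with `w j` copies of each `j`; pulling a relation back
-- along it turns weights into cardinalities.
blow-up : (w : Fin n → ℕ) → Fin (sum w) → Fin n
blow-up {suc n} w = [ (λ _ → zero) , suc ∘ blow-up (w ∘ suc) ]′ ∘ splitAt (w zero)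

count-blow-up : ∀ w (r : Fin n → Bool) → count (r ∘ blow-up w) ≡ sum (λ j → indicator (r j) * w j)
count-blow-up {zero}  w r = refl
count-blow-up {suc n} w r = begin
  count (r ∘ blow-up w)
    ≡⟨ count-splitAt (w zero) (r ∘ blow-up w) ⟩
  count (λ i → r (copies (splitAt (w zero) (i ↑ˡ W)))) +
  count (λ j → r (copies (splitAt (w zero) (w zero ↑ʳ j))))
    ≡⟨ cong₂ _+_ (count-cong λ i → cong (r ∘ copies) (Fin.splitAt-↑ˡ (w zero) i W))
                 (count-cong λ j → cong (r ∘ copies) (Fin.splitAt-↑ʳ (w zero) W j)) ⟩
  count {w zero} (λ _ → r zero) + count (r ∘ suc ∘ blow-up (w ∘ suc))
    ≡⟨ cong₂ _+_ (constant (r zero)) (count-blow-up (w ∘ suc) (r ∘ suc)) ⟩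
  indicator (r zero) * w zero + sum (λ j → indicator (r (suc j)) * w (suc j)) ∎
  where
  open ≡-Reasoning
  W = sum (w ∘ suc)
  copies : Fin (w zero) ⊎ Fin W → Fin (suc n)
  copies = [ (λ _ → zero) , suc ∘ blow-up (w ∘ suc) ]′
  constant : ∀ b → count {w zero} (λ _ → b) ≡ indicator b * w zero
  constant true  = trans (count-true (w zero)) (sym (ℕ.*-identityˡ (w zero)))
  constant false = count-false (w zero)

-- Degree bounds as linear inequalities

module Thresholds where
  open IntegerMatrices using (_∙_; ∙-congʳ)
  open import Data.Integer.Base using (+_; 0ℤ) renaming (∣_∣ to abs)

  -- Row r of a 0/1 matrix, scaled so that threshold q p r ∙ w ≥ 0 says that r
  -- carries at least the fraction p/q of the weight w.
  threshold : (q p : ℕ) → (Fin n → Bool) → Vector ℤ n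
  threshold q p r j = + (q * indicator (r j)) ℤ.- + p

  threshold-∙ : ∀ q p (r : Fin n → Bool) (w : Fin n → ℕ) →
                threshold q p r ∙ (+_ ∘ w) ≡ + (q * sum (λ j → indicator (r j) * w j)) ℤ.- + (p * sum w)
  threshold-∙ {zero}  q p r w = cong₂ (λ s t → + s ℤ.- + t) (sym (ℕ.*-zeroʳ q)) (sym (ℕ.*-zeroʳ p))
  threshold-∙ {suc n} q p r w = begin
    (+ (q * r₀) ℤ.- + p) ℤ.* + w₀ ℤ.+ threshold q p (r ∘ suc) ∙ (+_ ∘ w ∘ suc)
      ≡⟨ cong (ℤ._+_ ((+ (q * r₀) ℤ.- + p) ℤ.* + w₀)) (threshold-∙ q p (r ∘ suc) (w ∘ suc)) ⟩
    (+ (q * r₀) ℤ.- + p) ℤ.* + w₀ ℤ.+ (+ (q * X) ℤ.- + (p * W))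
      ≡⟨ collect (+ (q * r₀)) (+ p) (+ w₀) (+ (q * X)) (+ (p * W)) ⟩
    (+ (q * r₀) ℤ.* + w₀ ℤ.+ + (q * X)) ℤ.- (+ p ℤ.* + w₀ ℤ.+ + (p * W))
      ≡⟨ cong₂ (λ s t → (s ℤ.+ + (q * X)) ℤ.- (t ℤ.+ + (p * W))) (ℤ.pos-* (q * r₀) w₀) (ℤ.pos-* p w₀) ⟨
    + (q * r₀ * w₀ + q * X) ℤ.- + (p * w₀ + p * W)
      ≡⟨ cong₂ (λ s t → + s ℤ.- + t) (factor q r₀ w₀ X) (sym (ℕ.*-distribˡ-+ p w₀ W)) ⟩
    + (q * (r₀ * w₀ + X)) ℤ.- + (p * (w₀ + W)) ∎
    where
    open ≡-Reasoning
    r₀ = indicator (r zero)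
    w₀ = w zero
    W = sum (w ∘ suc)
    X = sum (λ j → indicator (r (suc j)) * w (suc j))
    collect : ∀ a b c d e → (a ℤ.- b) ℤ.* c ℤ.+ (d ℤ.- e) ≡ (a ℤ.* c ℤ.+ d) ℤ.- (b ℤ.* c ℤ.+ e)
    collect = solve-∀
    factor : ∀ q r w X → q * r * w + q * X ≡ q * (r * w + X)
    factor = ℕ-solve-∀

  -- Uniform weights do: a fraction of the weight is then a fraction of the `n` elements.
  degrees⇒feasible : ∀ p (R : Fin m → Fin n → Bool) → Fin n → (∀ i → p ℕ.≤ count (R i)) →
                     Feasible (threshold n p ∘ R)
  degrees⇒feasible {n = n} p R j p≤ = +_ ∘ w , ((λ _ → ℤ.+≤+ ℕ.z≤n) , j , ℤ.+<+ (ℕ.s≤s ℕ.z≤n)) , λ i →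
    subst (0ℤ ℤ.≤_) (sym (trans (threshold-∙ n p (R i) w) (cong₂ (λ s t → + (n * s) ℤ.- + t)
      (sum-cong-≗ λ j → ℕ.*-identityʳ (indicator (R i j)))
      (trans (cong (p *_) (count-true n)) (ℕ.*-comm p n)))))
    (ℤ.i≤j⇒0≤j-i (ℤ.+≤+ (ℕ.*-monoʳ-≤ n (p≤ i))))
    where
    w : Fin n → ℕ
    w _ = 1

  -- Integer weights are numbers of copies, so blowing up by `w` realises the weighted proportions
  -- as degrees. A positive weight makes the blown-up set nonempty.
  feasible⇒degrees : ∀ q p (R : Fin m → Fin n → Bool) → Feasible (threshold q p ∘ R) →
                     ∃[ k ] ∃[ g ] Fin k × (∀ i → p * k ℕ.≤ q * count {k} (R i ∘ g))
  feasible⇒degrees q p R (v , (v≥0 , j , vj>0) , Rv≥0) =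
    sum w , blow-up w , copy w j (ℤ.drop‿+<+ (subst (0ℤ ℤ.<_) (sym (v≡w j)) vj>0)) , λ i →
    subst (λ s → p * sum w ℕ.≤ q * s) (sym (count-blow-up w (R i)))
      (ℤ.drop‿+≤+ (ℤ.0≤i-j⇒j≤i (subst (0ℤ ℤ.≤_)
        (trans (∙-congʳ (threshold q p (R i)) (sym ∘ v≡w)) (threshold-∙ q p (R i) w)) (Rv≥0 i))))
    where
    w : Fin _ → ℕ
    w = abs ∘ v
    v≡w : ∀ j → + w j ≡ v j
    v≡w j = ℤ.0≤i⇒+∣i∣≡i (v≥0 j)
    copy : ∀ {n} (w : Fin n → ℕ) j → 0 ℕ.< w j → Fin (sum w)
    copy w zero    wj>0 = Fin.fromℕ< wj>0 ↑ˡ _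
    copy w (suc j) wj>0 = w zero ↑ʳ copy (w ∘ suc) j wj>0

open Thresholds using (threshold; degrees⇒feasible; feasible⇒degrees)

-- Rational and real bounds

ι≃ : ∀ m → ℚ.toℚᵘ (ι m) ℚᵘ.≃ mkℚᵘ (ℤ.+ m) 0
ι≃ m = ℚ.toℚᵘ-fromℚᵘ (mkℚᵘ (ℤ.+ m) 0)

ι-mono-≤ : m ℕ.≤ n → ι m ℚ.≤ ι n
ι-mono-≤ {m} {n} m≤n = ℚ.toℚᵘ-cancel-≤ (begin
  ℚ.toℚᵘ (ι m)   ≃⟨ ι≃ m ⟩
  mkℚᵘ (ℤ.+ m) 0 ≤⟨ *≤* (ℤ.*-monoʳ-≤-nonNeg (ℤ.+ 1) (ℤ.+≤+ m≤n)) ⟩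
  mkℚᵘ (ℤ.+ n) 0 ≃⟨ ι≃ n ⟨
  ℚ.toℚᵘ (ι n)   ∎)
  where open ℚᵘ.≤-Reasoning

ι-* : ∀ m n → ι (m * n) ≡ ι m ℚ.* ι n
ι-* m n = ℚ.toℚᵘ-injective (begin
  ℚ.toℚᵘ (ι (m * n))                 ≈⟨ ι≃ (m * n) ⟩
  mkℚᵘ (ℤ.+ (m * n)) 0               ≈⟨ *≡* (cong (ℤ._* ℤ.+ 1) (ℤ.pos-* m n)) ⟩
  mkℚᵘ (ℤ.+ m) 0 ℚᵘ.* mkℚᵘ (ℤ.+ n) 0 ≈⟨ ℚᵘ.*-cong (ι≃ m) (ι≃ n) ⟨
  ℚ.toℚᵘ (ι m) ℚᵘ.* ℚ.toℚᵘ (ι n)     ≈⟨ ℚ.toℚᵘ-homo-* (ι m) (ι n) ⟨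
  ℚ.toℚᵘ (ι m ℚ.* ι n)               ∎)
  where open import Relation.Binary.Reasoning.Setoid ℚᵘ.≃-setoid

fromℕ-mono-≤ : m ℕ.≤ n → fromℕ m ≤ fromℕ n
fromℕ-mono-≤ m≤n q<m = ℚ.<-≤-trans q<m (ι-mono-≤ m≤n)

-- This is `x ≤ n / m ≤ n′ / m′` with the denominators cleared, tested at every rational `p` below
-- `x`.
·≤-rescale : ∀ x m n m′ n′ → .{{ℕ.NonZero m}} →
             x · m ≤ fromℕ n → n * m′ ℕ.≤ m * n′ → x · m′ ≤ fromℕ n′
·≤-rescale x m n m′ n′ xm≤n nm′≤mn′ = ·≤⇐ x m′ n′ λ {p} p<x →
  ℚ.*-cancelˡ-≤-pos (ι m) {{ℚ.normalize-pos m 1}} (begin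
    ι m ℚ.* (p ℚ.* ι m′) ≡⟨ ℚ.*-assoc (ι m) p (ι m′) ⟨
    ι m ℚ.* p ℚ.* ι m′   ≡⟨ cong (ℚ._* ι m′) (ℚ.*-comm (ι m) p) ⟩
    p ℚ.* ι m ℚ.* ι m′   ≤⟨ ℚ.*-monoʳ-≤-nonNeg (ι m′) {{ℚ.normalize-nonNeg m′ 1}} (·≤⇒ x m n xm≤n p<x) ⟩
    ι n ℚ.* ι m′         ≡⟨ ι-* n m′ ⟨
    ι (n * m′)           ≤⟨ ι-mono-≤ nm′≤mn′ ⟩
    ι (m * n′)           ≡⟨ ι-* m n′ ⟩
    ι m ℚ.* ι n′         ∎)
  where open ℚ.≤-Reasoning

-- D ranges over relations contained in "not at distance two". The last
-- line says that at least z · α vertices lie outside D c, without subtraction.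
CyclicReaches : (x y : ⟨0,1]) → ℝ → Set
CyclicReaches x y z =
  ∀ {α β γ} → Fin α → Fin β → Fin γ →
  (R : Fin α → Fin β → Bool) (S : Fin β → Fin γ → Bool) (D : Fin γ → Fin α → Bool) →
  (∀ {a b c} → T (R a b) → T (S b c) → ¬ T (D c a)) →
  (∀ a → value x · β ≤ fromℕ (count (R a))) →
  (∀ b → value y · γ ≤ fromℕ (count (S b))) →
  ∃[ c ] ∃[ k ] z · α ≤ fromℕ k × k + count (D c) ℕ.≤ α

-- Reversing a cyclic system of relations

nonZero : Fin n → ℕ.NonZero n
nonZero zero    = _
nonZero (suc _) = _

-- The minimum degrees `r`, `s` and `δ` give the proportions to be kept, and a vertex `d` of least
-- `D`-degree is the answer. The reversed system runs from C to B to A, so in it `x` bounds the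
-- transpose of `S` and `y` that of `R`, as `reaches` requires. It yields `a` with
-- `z ≤ k / γ′ ≤ 1 - δ / α`, which is the bound at `d`.
cyclicReaches-swap : ∀ x y z → CyclicReaches x y z → CyclicReaches y x z
cyclicReaches-swap x y z reaches {α} {β} {γ} a₀ b₀ c₀ R S D no-triangle R-deg S-deg =
  d , α ∸ count (D d) ,
  ·≤-rescale z γ′ k α (α ∸ δ) {{nonZero c₁}} zγ′≤k kα≤γ′[α∸δ] ,
  ℕ.≤-reflexive (ℕ.m∸n+n≡m (count≤n (D d)))
  where
  -- Attained minima turn the real bounds into the fractions `r / β`, `s / γ` and `δ / α`, to which
  -- integer linear algebra applies.
  min-R = minimum (count ∘ R) a₀
  min-S = minimum (count ∘ S) b₀
  min-D = minimum (count ∘ D) c₀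
  r = count (R (proj₁ min-R))
  s = count (S (proj₁ min-S))
  d = proj₁ min-D
  δ = count (D d)
  open TransposeFeasible (transpose-cycle (threshold β r ∘ R) (threshold γ s ∘ S) (threshold α δ ∘ D)
    (degrees⇒feasible r R b₀ (proj₂ min-R))
    (degrees⇒feasible s S c₀ (proj₂ min-S))
    (degrees⇒feasible δ D a₀ (proj₂ min-D)))
  A′ = feasible⇒degrees β r (λ j i → R (f i) (g j)) Mᵀ
  B′ = feasible⇒degrees γ s (λ k j → S (g j) (h k)) Nᵀ
  C′ = feasible⇒degrees α δ (λ i k → D (h k) (f i)) Pᵀ
  α′ = proj₁ A′
  β′ = proj₁ B′
  γ′ = proj₁ C′
  f′ : Fin α′ → Fin _
  f′ = proj₁ (proj₂ A′)
  g′ : Fin β′ → Fin _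
  g′ = proj₁ (proj₂ B′)
  h′ : Fin γ′ → Fin _
  h′ = proj₁ (proj₂ C′)
  a₁ = proj₁ (proj₂ (proj₂ A′))
  b₁ = proj₁ (proj₂ (proj₂ B′))
  c₁ = proj₁ (proj₂ (proj₂ C′))
  reversed = reaches c₁ b₁ a₁
    (λ k j → S (g (g′ j)) (h (h′ k))) (λ j i → R (f (f′ i)) (g (g′ j))) (λ i k → D (h (h′ k)) (f (f′ i)))
    (λ scb rba → no-triangle rba scb)
    (λ k → ·≤-rescale (value x) γ s β′ _ {{nonZero c₀}} (S-deg (proj₁ min-S))
           (proj₂ (proj₂ (proj₂ B′)) (h′ k)))
    (λ j → ·≤-rescale (value y) β r α′ _ {{nonZero b₀}} (R-deg (proj₁ min-R))
           (proj₂ (proj₂ (proj₂ A′)) (g′ j)))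
  a = proj₁ reversed
  k = proj₁ (proj₂ reversed)
  zγ′≤k = proj₁ (proj₂ (proj₂ reversed))
  e = count (λ k → D (h (h′ k)) (f (f′ a)))
  -- The reversed `D`-degree `e` of `a` is at least `γ′ * δ / α`, and `k + e ≤ γ′` leaves at most
  -- the proportion `(α - δ) / α` of `γ′` for `k`.
  kα≤γ′[α∸δ] : k * α ℕ.≤ γ′ * (α ∸ δ)
  kα≤γ′[α∸δ] = begin
    k * α               ≤⟨ ℕ.m+n≤o⇒m≤o∸n (k * α) (begin
      k * α + γ′ * δ      ≡⟨ cong (k * α +_) (ℕ.*-comm γ′ δ) ⟩
      k * α + δ * γ′      ≤⟨ ℕ.+-monoʳ-≤ (k * α) (proj₂ (proj₂ (proj₂ C′)) (f′ a)) ⟩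
      k * α + α * e       ≡⟨ cong (k * α +_) (ℕ.*-comm α e) ⟩
      k * α + e * α       ≡⟨ ℕ.*-distribʳ-+ α k e ⟨
      (k + e) * α         ≤⟨ ℕ.*-monoˡ-≤ α (proj₂ (proj₂ (proj₂ reversed))) ⟩
      γ′ * α              ∎) ⟩
    γ′ * α ∸ γ′ * δ     ≡⟨ ℕ.*-distribˡ-∸ γ′ α δ ⟨
    γ′ * (α ∸ δ)        ∎
    where open ℕ.≤-Reasoning

-- Graphs and relations

T-does⁺ : {P : Set} (P? : Dec P) → P → T (does P?)
T-does⁺ P? p = Equivalence.from T-≡ (dec-true P? p)

T-does⁻ : {P : Set} (P? : Dec P) → T (does P?) → P
T-does⁻ (yes p) _ = p

∈-tabulate⁺ : {r : Fin n → Bool} {i : Fin n} → T (r i) → i ∈ tabulate r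
∈-tabulate⁺ {r = r} {i} ri = lookup⇒[]= i _ (trans (lookup∘tabulate r i) (Equivalence.to T-≡ ri))

∈-tabulate⁻ : {r : Fin n → Bool} {i : Fin n} → i ∈ tabulate r → T (r i)
∈-tabulate⁻ {r = r} {i} i∈ = Equivalence.from T-≡ (trans (sym (lookup∘tabulate r i)) ([]=⇒lookup i∈))

∣∣≡count : (S : Subset n) → ∣ S ∣ ≡ count (lookup S)
∣∣≡count Vec.[]            = refl
∣∣≡count (true  Vec.∷ S) = cong suc (∣∣≡count S)
∣∣≡count (false Vec.∷ S) = ∣∣≡count S

-- Testing on singletons shows that this makes `e` a bijection onto `S`. The form with an arbitrary
-- `r` is the one in which neighbourhoods get counted.
Enumerates : (Fin m → Fin n) → Subset n → Set
Enumerates {n = n} e S = ∀ (r : Fin n → Bool) → ∣ tabulate r ∩ S ∣ ≡ count (r ∘ e)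

enumeration : (S : Subset n) → Fin ∣ S ∣ → Fin n
enumeration (true  Vec.∷ S) zero    = zero
enumeration (true  Vec.∷ S) (suc i) = suc (enumeration S i)
enumeration (false Vec.∷ S) i       = suc (enumeration S i)

enumeration-∈ : (S : Subset n) (i : Fin ∣ S ∣) → enumeration S i ∈ S
enumeration-∈ (true  Vec.∷ S) zero    = here
enumeration-∈ (true  Vec.∷ S) (suc i) = there (enumeration-∈ S i)
enumeration-∈ (false Vec.∷ S) i       = there (enumeration-∈ S i)

enumeration-enumerates : (S : Subset n) → Enumerates (enumeration S) S
enumeration-enumerates Vec.[] r = refl
enumeration-enumerates (true  Vec.∷ S) r with r zero
... | true  = cong suc (enumeration-enumerates S (r ∘ suc))
... | false = enumeration-enumerates S (r ∘ suc)
enumeration-enumerates (false Vec.∷ S) r with r zero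
... | true  = enumeration-enumerates S (r ∘ suc)
... | false = enumeration-enumerates S (r ∘ suc)

-- Merely shows that `Fin ∣ S ∣` is inhabited: the result is the first index, whichever member is
-- given.
index : {S : Subset n} → ∃ (_∈ S) → Fin ∣ S ∣
index {S = true  Vec.∷ S} _                 = zero
index {S = false Vec.∷ S} (suc i , there i∈) = index (i , i∈)

-- `D` is taken to be all pairs not at distance two. The vertices of `A` outside `D c` are then
-- those in `N²`, so the subtraction-free bound turns into `k ≤ ∣ N² G (eC c) ∩ A ∣`.
cyclicReaches⇒reaches : ∀ x y z → CyclicReaches x y z → Reaches x y z
cyclicReaches⇒reaches x y z reaches G A B C con =
  let c , k , zα≤k , k+D≤α = reaches (index A≢∅) (index B≢∅) (index C≢∅)
        (λ i j → adjacent (eA i) (eB j)) (λ j k → adjacent (eB j) (eC k)) (λ k i → not (far (eC k) (eA i)))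
        (λ {i} {j} {k} ab bc → not-T (T-does⁺ (distance? G 2 (eC k) (eA i))
          (distance-2 (enumeration-∈ A i) (enumeration-∈ C k) ab bc)))
        (λ i → subst (λ s → value x · ∣ B ∣ ≤ fromℕ s)
          (enumeration-enumerates B (adjacent (eA i))) (A→B (enumeration-∈ A i)))
        (λ j → subst (λ s → value y · ∣ C ∣ ≤ fromℕ s)
          (enumeration-enumerates C (adjacent (eB j))) (B→C (enumeration-∈ B j)))
      reached = λ i → far (eC c) (eA i)
      k≤ : k ℕ.≤ ∣ N² G (eC c) ∩ A ∣
      k≤ = subst (k ℕ.≤_) (sym (enumeration-enumerates A (far (eC c))))
        (ℕ.+-cancelʳ-≤ (count (not ∘ reached)) _ _ (ℕ.≤-trans k+D≤α (ℕ.≤-reflexive (sym (count-not reached)))))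
  in eC c , enumeration-∈ C c , λ q<zα → fromℕ-mono-≤ k≤ (zα≤k q<zα)
  where
  open Graph G
  open Constrained con
  open Tripartition tripartition
  eA = enumeration A
  eB = enumeration B
  eC = enumeration C
  far : Vertex G → Vertex G → Bool
  far c a = does (distance? G 2 c a)
  not-T : ∀ {b} → T b → ¬ T (not b)
  not-T {true} _ ()
  Adj-sym : ∀ {u v} → Adj G u v → Adj G v u
  Adj-sym {u} {v} = subst T (symmetric u v)
  distance-2 : ∀ {a b c} → a ∈ A → c ∈ C → Adj G a b → Adj G b c → Distance G 2 c a
  -- The walk through `b` has length two; disjointness of `A` and `C` rules out length zero, and
  -- `no-AC` rules out length one.
  distance-2 {a} {b} {c} a∈A c∈C ab bc = (b , Adj-sym bc , a , Adj-sym ab , refl) , λ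
    { {zero}        _ refl            → A∩C≡∅ (a , x∈p∩q⁺ (a∈A , c∈C))
    ; {suc zero}    _ (_ , ca , refl) → no-AC a∈A c∈C (Adj-sym ca)
    ; {suc (suc _)} (ℕ.s≤s (ℕ.s≤s ())) }

-- The tripartite graph of two relations

module TripartiteGraph {α β γ} (R : Fin α → Fin β → Bool) (S : Fin β → Fin γ → Bool) where

  Part : Set
  Part = Fin α ⊎ (Fin β ⊎ Fin γ)

  pattern inA a = inj₁ a
  pattern inB b = inj₂ (inj₁ b)
  pattern inC c = inj₂ (inj₂ c)

  part : Fin (α + (β + γ)) → Part
  part = [ inj₁ , inj₂ ∘ splitAt β ]′ ∘ splitAt α

  vertex : Part → Fin (α + (β + γ))
  vertex (inA a) = a ↑ˡ (β + γ)
  vertex (inB b) = α ↑ʳ (b ↑ˡ γ)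
  vertex (inC c) = α ↑ʳ (β ↑ʳ c)

  part-vertex : ∀ p → part (vertex p) ≡ p
  part-vertex (inA a) rewrite Fin.splitAt-↑ˡ α a (β + γ) = refl
  part-vertex (inB b) rewrite Fin.splitAt-↑ʳ α (β + γ) (b ↑ˡ γ) | Fin.splitAt-↑ˡ β b γ = refl
  part-vertex (inC c) rewrite Fin.splitAt-↑ʳ α (β + γ) (β ↑ʳ c) | Fin.splitAt-↑ʳ β γ c = refl

  count-parts : ∀ r → count r ≡ count (r ∘ vertex ∘ inj₁) +
                (count (λ b → r (vertex (inB b))) + count (λ c → r (vertex (inC c))))
  count-parts r = trans (count-splitAt α r)
    (cong (count (r ∘ vertex ∘ inj₁) +_) (count-splitAt β (r ∘ (α ↑ʳ_))))

  link : Part → Part → Bool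
  link (inA a) (inB b) = R a b
  link (inB b) (inA a) = R a b
  link (inB b) (inC c) = S b c
  link (inC c) (inB b) = S b c
  link _       _       = false

  link-sym : ∀ p q → link p q ≡ link q p
  link-sym (inA _) (inA _) = refl
  link-sym (inA _) (inB _) = refl
  link-sym (inA _) (inC _) = refl
  link-sym (inB _) (inA _) = refl
  link-sym (inB _) (inB _) = refl
  link-sym (inB _) (inC _) = refl
  link-sym (inC _) (inA _) = refl
  link-sym (inC _) (inB _) = refl
  link-sym (inC _) (inC _) = refl

  link-irrefl : ∀ p → link p p ≡ false
  link-irrefl (inA _) = refl
  link-irrefl (inB _) = refl
  link-irrefl (inC _) = refl

  G : Graph
  G = record
    { order       = α + (β + γ)
    ; adjacent    = λ u v → link (part u) (part v)
    ; symmetric   = λ u v → link-sym (part u) (part v)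
    ; irreflexive = link-irrefl ∘ part
    }

  isA isB isC : Part → Bool
  isA (inA _) = true
  isA _       = false
  isB (inB _) = true
  isB _       = false
  isC (inC _) = true
  isC _       = false

  A B C : Subset (α + (β + γ))
  A = tabulate (isA ∘ part)
  B = tabulate (isB ∘ part)
  C = tabulate (isC ∘ part)

  fibre : (is : Part → Bool) (p : Part) (r : Fin (α + (β + γ)) → Bool) →
          lookup (tabulate r ∩ tabulate (is ∘ part)) (vertex p) ≡ r (vertex p) ∧ is p
  fibre is p r = begin
    lookup (tabulate r ∩ tabulate (is ∘ part)) (vertex p)
      ≡⟨ lookup-zipWith _∧_ (vertex p) (tabulate r) (tabulate (is ∘ part)) ⟩
    lookup (tabulate r) (vertex p) ∧ lookup (tabulate (is ∘ part)) (vertex p)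
      ≡⟨ cong₂ _∧_ (lookup∘tabulate r (vertex p))
                   (trans (lookup∘tabulate (is ∘ part) (vertex p)) (cong is (part-vertex p))) ⟩
    r (vertex p) ∧ is p ∎
    where open ≡-Reasoning

  inside : ∀ {m} (is : Part → Bool) (into : Fin m → Part) → (∀ i → is (into i) ≡ true) →
           ∀ r → count (λ i → lookup (tabulate r ∩ tabulate (is ∘ part)) (vertex (into i))) ≡
                 count (r ∘ vertex ∘ into)
  inside is into is-into r = count-cong λ i →
    trans (fibre is (into i) r) (trans (cong (r (vertex (into i)) ∧_) (is-into i)) (∧-identityʳ _))

  outside : ∀ {m} (is : Part → Bool) (into : Fin m → Part) → (∀ i → is (into i) ≡ false) →
            ∀ r → count (λ i → lookup (tabulate r ∩ tabulate (is ∘ part)) (vertex (into i))) ≡ 0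
  outside {m} is into is-into r = trans (count-cong λ i →
    trans (fibre is (into i) r) (trans (cong (r (vertex (into i)) ∧_) (is-into i)) (∧-zeroʳ _)))
    (count-false m)

  A-enumerates : Enumerates (λ a → vertex (inA a)) A
  A-enumerates r = trans (∣∣≡count (tabulate r ∩ A)) (trans (count-parts _) (trans
    (cong₂ _+_ (inside isA (λ a → inA a) (λ _ → refl) r)
      (cong₂ _+_ (outside isA (λ b → inB b) (λ _ → refl) r) (outside isA (λ c → inC c) (λ _ → refl) r)))
    (ℕ.+-identityʳ _)))

  B-enumerates : Enumerates (λ b → vertex (inB b)) B
  B-enumerates r = trans (∣∣≡count (tabulate r ∩ B)) (trans (count-parts _) (trans
    (cong₂ _+_ (outside isB (λ a → inA a) (λ _ → refl) r)
      (cong₂ _+_ (inside isB (λ b → inB b) (λ _ → refl) r) (outside isB (λ c → inC c) (λ _ → refl) r)))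
    (ℕ.+-identityʳ _)))

  C-enumerates : Enumerates (λ c → vertex (inC c)) C
  C-enumerates r = trans (∣∣≡count (tabulate r ∩ C)) (trans (count-parts _)
    (cong₂ _+_ (outside isC (λ a → inA a) (λ _ → refl) r)
      (cong₂ _+_ (outside isC (λ b → inB b) (λ _ → refl) r) (inside isC (λ c → inC c) (λ _ → refl) r))))

enumerates⇒size : (e : Fin m → Fin n) (S : Subset n) → Enumerates e S → ∣ S ∣ ≡ m
enumerates⇒size {m} e S enum = trans (cong ∣_∣ (sym all∩S)) (trans (enum (λ _ → true)) (count-true m))
  where
  all∩S : tabulate (λ _ → true) ∩ S ≡ S
  all∩S = ⊆-antisym (λ i∈ → proj₂ (x∈p∩q⁻ _ _ i∈)) (λ i∈S → x∈p∩q⁺ (∈-tabulate⁺ _ , i∈S))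

-- In the graph built from `R` and `S`, a walk of length two from C to A passes through B, so by
-- `no-triangle` a vertex of A at distance two from `c` lies outside `D c`. The number of these
-- vertices serves as `k`.
reaches⇒cyclicReaches : ∀ x y z → Reaches x y z → CyclicReaches x y z
reaches⇒cyclicReaches x y z reaches {α} {β} {γ} a₀ b₀ c₀ R S D no-triangle R-deg S-deg =
  let v , v∈C , zA≤N² = reaches G A B C constrained
      c , v≡c = isC⇒inC (part v) (∈-tabulate⁻ v∈C)
      far = λ a → does (distance? G 2 v (vertex (inA a)))
  in c , count far ,
     subst₂ (λ s t → z · s ≤ fromℕ t) (enumerates⇒size (vertex ∘ inj₁) A A-enumerates)
       (A-enumerates (λ u → does (distance? G 2 v u))) zA≤N² ,
     count-disjoint far (D c) λ a reached → walk-no-D v≡c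
       (proj₁ (T-does⁻ (distance? G 2 v (vertex (inA a))) reached))
  where
  open TripartiteGraph R S

  isC⇒inC : ∀ p → T (isC p) → ∃[ c ] p ≡ inC c
  isC⇒inC (inC c) _ = c , refl

  middle : ∀ {a c} q → T (link (inC c) q) → T (link q (inA a)) → ∃[ b ] T (R a b) × T (S b c)
  middle (inB b) bc ab = b , ab , bc

  walk-no-D : ∀ {v a c} → part v ≡ inC c → Walk G 2 v (vertex (inA a)) → ¬ T (D c a)
  walk-no-D {a = a} v≡c (w , vw , _ , wa , refl) =
    let b , ab , bc = middle (part w) (subst (λ p → T (link p (part w))) v≡c vw)
                        (subst (λ p → T (link (part w) p)) (part-vertex (inA a)) wa)
    in no-triangle ab bc

  disjoint : (is is′ : Part → Bool) → (∀ p → T (is p) → ¬ T (is′ p)) →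
             Empty (tabulate (is ∘ part) ∩ tabulate (is′ ∘ part))
  disjoint is is′ dis (v , v∈) = let v∈₁ , v∈₂ = x∈p∩q⁻ _ _ v∈ in
    dis (part v) (∈-tabulate⁻ v∈₁) (∈-tabulate⁻ v∈₂)

  stable : (is : Part → Bool) → (∀ p q → T (is p) → T (is q) → ¬ T (link p q)) →
           Stable G (tabulate (is ∘ part))
  stable is no-link u∈ v∈ = no-link _ _ (∈-tabulate⁻ u∈) (∈-tabulate⁻ v∈)

  nonempty : (is : Part → Bool) (p : Part) → T (is p) → Nonempty (tabulate (is ∘ part))
  nonempty is p isp = vertex p , ∈-tabulate⁺ (subst (T ∘ is) (sym (part-vertex p)) isp)

  covered : ∀ v p → part v ≡ p → v ∈ A ∪ B ∪ C
  covered v (inA _) eq = x∈p∪q⁺ (inj₁ (∈-tabulate⁺ (subst (T ∘ isA) (sym eq) _)))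
  covered v (inB _) eq = x∈p∪q⁺ (inj₂ (x∈p∪q⁺ (inj₁ (∈-tabulate⁺ (subst (T ∘ isB) (sym eq) _)))))
  covered v (inC _) eq = x∈p∪q⁺ (inj₂ (x∈p∪q⁺ (inj₂ (∈-tabulate⁺ (subst (T ∘ isC) (sym eq) _)))))

  degree : ∀ (t : ℝ) {k} (into : Fin k → Part) X → Enumerates (vertex ∘ into) X →
           ∀ v → t · k ≤ fromℕ (count (link (part v) ∘ into)) → t · ∣ X ∣ ≤ fromℕ ∣ N G v ∩ X ∣
  degree t into X enum v = subst₂ (λ s d → t · s ≤ fromℕ d)
    (sym (enumerates⇒size (vertex ∘ into) X enum)) (sym (begin
      ∣ N G v ∩ X ∣                                        ≡⟨ enum (λ u → link (part v) (part u)) ⟩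
      count (λ i → link (part v) (part (vertex (into i))))
        ≡⟨ count-cong (λ i → cong (link (part v)) (part-vertex (into i))) ⟩
      count (link (part v) ∘ into)                         ∎))
    where open ≡-Reasoning

  A-degree : ∀ p → T (isA p) → value x · β ≤ fromℕ (count (λ b → link p (inB b)))
  A-degree (inA a) _ = R-deg a

  B-degree : ∀ p → T (isB p) → value y · γ ≤ fromℕ (count (λ c → link p (inC c)))
  B-degree (inB b) _ = S-deg b

  constrained : Constrained G x y A B C
  constrained = record
    { tripartition = record
      { A≢∅ = nonempty isA (inA a₀) _
      ; B≢∅ = nonempty isB (inB b₀) _
      ; C≢∅ = nonempty isC (inC c₀) _
      ; A∩B≡∅ = disjoint isA isB λ { (inA _) _ () }
      ; B∩C≡∅ = disjoint isB isC λ { (inB _) _ () }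
      ; A∩C≡∅ = disjoint isA isC λ { (inA _) _ () }
      ; cover = ⊆-antisym ⊆⊤ λ {v} _ → covered v (part v) refl
      ; stable-A = stable isA λ { (inA _) (inA _) _ _ () }
      ; stable-B = stable isB λ { (inB _) (inB _) _ _ () }
      ; stable-C = stable isC λ { (inC _) (inC _) _ _ () }
      }
    ; A→B = λ {v} v∈A → degree (value x) (λ b → inB b) B B-enumerates v (A-degree (part v) (∈-tabulate⁻ v∈A))
    ; B→C = λ {v} v∈B → degree (value y) (λ c → inC c) C C-enumerates v (B-degree (part v) (∈-tabulate⁻ v∈B))
    ; no-AC = λ {u} {v} u∈A v∈C → no-link (part u) (part v) (∈-tabulate⁻ u∈A) (∈-tabulate⁻ v∈C)
    }
    where
    no-link : ∀ p q → T (isA p) → T (isC q) → ¬ T (link p q)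
    no-link (inA _) (inC _) _ _ ()

-- By maximality of `φ y x` it suffices that `value (φ x y)` is reached for `y` and `x` in swapped
-- order; the cyclic form, where reversal is possible, carries this across.
φ-≤-swap : ∀ x y → value (φ x y) ≤ value (φ y x)
φ-≤-swap x y = proj₂ (φ-isMaximum y x) (φ x y)
  (cyclicReaches⇒reaches y x z (cyclicReaches-swap x y z
    (reaches⇒cyclicReaches x y z (proj₁ (φ-isMaximum x y)))))
  where z = value (φ x y)

mainTheorem1 : ∀ (x y : ⟨0,1]) → value (φ x y) ≃ value (φ y x)
mainTheorem1 x y = φ-≤-swap x y , φ-≤-swap y x
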